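{- Let $G$ be a graph with minimum degree $\delta(G)\ge 2$. If $G\not\cong kC_5$ for every positive integer $k$, then $m_G[0,1)\le \nu(G)-1$.
   Context: All graphs are simple and finite, with at least one vertex. The signless Laplacian matrix of a graph $G$ is $Q(G)=D(G)+A(G)$, where $D(G)$ is the diagonal matrix of vertex degrees and $A(G)$ is the adjacency matrix; its eigenvalues are the signless Laplacian eigenvalues of $G$. For an $n$-vertex graph $G$ they are all real and lie in $[0,2n-2]$. For a real interval $I$, $m_GI$ denotes the number of signless Laplacian eigenvalues of $G$ lying in $I$, counted with multiplicity. $\nu(G)$ is the matching number of $G$, i.e. the size of a maximum matching. $C_5$ is the cycle on $5$ vertices, and $kC_5$ is the disjoint union of $k$ copies of $C_5$. -}

module Defs where

open import Algebra.Apartness.Bundles using (HeytingField)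
open import Algebra.Bundles using (CommutativeRing)
import Algebra.Definitions.RawMonoid as RawMonoidDefinitions
open import Data.Bool.Base using (Bool; true; false; T; if_then_else_; _∧_; _∨_)
open import Data.Bool.Properties using (∨-comm)
open import Data.Fin.Base using (Fin; zero; suc; toℕ)
import Data.Fin.Properties as Fin
open import Data.Fin.Subset using (Subset; ∣_∣)
open import Data.List.Base using (List; length)
open import Data.List.Relation.Unary.All using (All)
open import Data.List.Relation.Unary.AllPairs using (AllPairs)
open import Data.Nat.Base as ℕ using (ℕ)
open import Data.Nat.DivMod using (_%_)
import Data.Nat.Properties as ℕ
open import Data.Product.Base using (Σ-syntax; ∃-syntax; _×_; _,_; uncurry)
open import Data.Sum.Base using (_⊎_)
open import Data.Vec.Base using (tabulate)
open import Data.Vec.Functional using (Vector)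
open import Function.Bundles using (_↔_; _⇔_; Inverse)
open import Level using (Level; _⊔_)
open import Relation.Binary.Core using (Rel)
open import Relation.Binary.PropositionalEquality using (_≡_; _≢_; refl; sym; cong₂)
open import Relation.Binary.Structures using (IsStrictPartialOrder)
open import Relation.Nullary.Decidable using (does; yes; no)
open import Relation.Nullary.Negation using (¬_; contradiction)
open import Relation.Unary using (Pred)

module ℕΣ = RawMonoidDefinitions ℕ.+-0-rawMonoid

------------------------------------------------------------------------
-- Graphs

record Graph (V : Set) : Set where
  field
    adj        : V → V → Bool
    adj-sym    : ∀ u v → adj u v ≡ adj v u
    adj-irrefl : ∀ v → adj v v ≡ false

open Graph public

infix 4 _≅_

_≅_ : {V W : Set} → Graph V → Graph W → Set
_≅_ {V} {W} G H =
  Σ[ f ∈ V ↔ W ] (∀ u v → adj G u v ≡ adj H (Inverse.to f u) (Inverse.to f v))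

neighbours : ∀ {n} → Graph (Fin n) → Fin n → Subset n
neighbours G v = tabulate (adj G v)

degree : ∀ {n} → Graph (Fin n) → Fin n → ℕ
degree G v = ∣ neighbours G v ∣

module _ {V : Set} where

  Disjoint : V × V → V × V → Set
  Disjoint (u , v) (x , y) = (u ≢ x × u ≢ y) × (v ≢ x × v ≢ y)

  record Matching (G : Graph V) : Set where
    field
      edges    : List (V × V)
      areEdges : All (uncurry λ u v → T (adj G u v)) edges
      disjoint : AllPairs Disjoint edges

    size : ℕ
    size = length edges

  IsMatchingNumber : Graph V → ℕ → Set
  IsMatchingNumber G ν =
    (∃[ M ] Matching.size {G} M ≡ ν) × (∀ M → Matching.size {G} M ℕ.≤ ν)

C₅ : Graph (Fin 5)
C₅ = record
  { adj        = λ i j → next i j ∨ next j i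
  ; adj-sym    = λ i j → ∨-comm (next i j) (next j i)
  ; adj-irrefl = λ where
      zero                         → refl
      (suc zero)                   → refl
      (suc (suc zero))             → refl
      (suc (suc (suc zero)))       → refl
      (suc (suc (suc (suc zero)))) → refl
  }
  where
  next : Fin 5 → Fin 5 → Bool
  next i j = does (toℕ j ℕ.≟ ℕ.suc (toℕ i) % 5)

infixr 8 _copiesOf_

-- The disjoint union of k copies of G.
_copiesOf_ : {V : Set} (k : ℕ) → Graph V → Graph (Fin k × V)
k copiesOf G = record
  { adj        = λ (i , u) (j , v) → does (i Fin.≟ j) ∧ adj G u v
  ; adj-sym    = λ (i , u) (j , v) → cong₂ _∧_ (≟-sym i j) (adj-sym G u v)
  ; adj-irrefl = λ (i , v) → irrefl′ (does (i Fin.≟ i)) (adj-irrefl G v)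
  }
  where
  ≟-sym : (i j : Fin k) → does (i Fin.≟ j) ≡ does (j Fin.≟ i)
  ≟-sym i j with i Fin.≟ j | j Fin.≟ i
  ... | yes _   | yes _   = refl
  ... | no  _   | no  _   = refl
  ... | yes i≡j | no  j≢i = contradiction (sym i≡j) j≢i
  ... | no  i≢j | yes j≡i = contradiction (sym j≡i) i≢j

  irrefl′ : ∀ b {c} → c ≡ false → b ∧ c ≡ false
  irrefl′ false _    = refl
  irrefl′ true  refl = refl

------------------------------------------------------------------------
-- The real numbers

-- ℝ is given axiomatically, as a Cauchy complete Archimedean ordered
-- field; these axioms determine it up to isomorphism.  The order is not
-- assumed decidable, so that constructive (Cauchy) reals are a model;
-- under excluded middle the axioms are the usual ones.
record RealNumbers (c ℓ₁ ℓ₂ : Level) : Set (Level.suc (c ⊔ ℓ₁ ⊔ ℓ₂)) where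
  field
    heytingField : HeytingField c ℓ₁ ℓ₂

  open HeytingField heytingField public
    hiding (refl; sym; trans; reflexive)

  commutativeRing : CommutativeRing c ℓ₁
  commutativeRing = record { isCommutativeRing = isCommutativeRing }

  open CommutativeRing commutativeRing using (+-rawMonoid)
  open RawMonoidDefinitions +-rawMonoid public
    using (sum) renaming (_×_ to _·_)

  infix 4 _<_ _≤_

  field
    _<_                  : Rel Carrier ℓ₂
    isStrictPartialOrder : IsStrictPartialOrder _≈_ _<_
    #⇔<⊎>                : ∀ x y → x # y ⇔ (x < y ⊎ y < x)
    +-monoʳ-<            : ∀ z {x y} → x < y → z + x < z + y
    *-pos                : ∀ {x y} → 0# < x → 0# < y → 0# < x * y
    archimedean          : ∀ x → ∃[ n ] x < n · 1#

  _≤_ : Rel Carrier ℓ₂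
  x ≤ y = ¬ (y < x)

  Within : Carrier → Rel Carrier ℓ₂
  Within ε x y = x < y + ε × y < x + ε

  field
    complete : (x : ℕ → Carrier) →
      (∀ ε → 0# < ε → ∃[ N ] (∀ m n → N ℕ.≤ m → N ℕ.≤ n → Within ε (x m) (x n))) →
      ∃[ l ] (∀ ε → 0# < ε → ∃[ N ] (∀ n → N ℕ.≤ n → Within ε (x n) l))

------------------------------------------------------------------------
-- Eigenvalues

module Spectrum {c ℓ₁ ℓ₂} (ℝ : RealNumbers c ℓ₁ ℓ₂) where
  open RealNumbers ℝ

  Matrix : ℕ → Set c
  Matrix n = Fin n → Fin n → Carrier

  infixr 7 _*ᵥ_

  _*ᵥ_ : ∀ {n} → Matrix n → Vector Carrier n → Vector Carrier n
  (M *ᵥ x) i = sum (λ j → M i j * x j)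

  combination : ∀ {d n} → Vector Carrier d → (Fin d → Vector Carrier n) → Vector Carrier n
  combination a b i = sum (λ k → a k * b k i)

  _∈Eigenspace[_,_] : ∀ {n} → Vector Carrier n → Matrix n → Carrier → Set ℓ₁
  x ∈Eigenspace[ M , μ ] = ∀ i → (M *ᵥ x) i ≈ μ * x i

  IsEigenvalue : ∀ {n} → Matrix n → Carrier → Set (c ⊔ ℓ₁ ⊔ ℓ₂)
  IsEigenvalue M μ = ∃[ x ] (∃[ i ] x i # 0#) × x ∈Eigenspace[ M , μ ]

  -- The eigenspace of M for μ has dimension d.  For the symmetric matrices
  -- considered here, this is the multiplicity of μ in every sense.
  record HasMultiplicity {n} (M : Matrix n) (μ : Carrier) (d : ℕ) : Set (c ⊔ ℓ₁) where
    field
      basis       : Fin d → Vector Carrier n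
      eigenbasis  : ∀ k → basis k ∈Eigenspace[ M , μ ]
      independent : ∀ a → (∀ i → combination a basis i ≈ 0#) → ∀ k → a k ≈ 0#
      spanning    : ∀ x → x ∈Eigenspace[ M , μ ] →
                    ∃[ a ] (∀ i → x i ≈ combination a basis i)

  -- M has exactly m eigenvalues in I, counted with multiplicity.  This is
  -- a relation rather than a function, as without excluded middle the
  -- eigenvalues of a real matrix cannot be enumerated in general.
  record EigenvalueCount {n ℓ} (M : Matrix n) (I : Pred Carrier ℓ) (m : ℕ)
         : Set (c ⊔ ℓ₁ ⊔ ℓ₂ ⊔ ℓ) where
    field
      {r}          : ℕ
      eigenvalue   : Fin r → Carrier
      isEigenvalue : ∀ k → IsEigenvalue M (eigenvalue k)
      inInterval   : ∀ k → I (eigenvalue k)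
      distinct     : ∀ k l → k ≢ l → eigenvalue k # eigenvalue l
      exhaustive   : ∀ μ → IsEigenvalue M μ → I μ → ∃[ k ] μ ≈ eigenvalue k
      multiplicity : Fin r → ℕ
      hasMult      : ∀ k → HasMultiplicity M (eigenvalue k) (multiplicity k)
      total        : ℕΣ.sum multiplicity ≡ m

  [_,_⟩ : Carrier → Carrier → Pred Carrier ℓ₂
  [ a , b ⟩ x = a ≤ x × x < b

  degreeMatrix adjacencyMatrix signlessLaplacian : ∀ {n} → Graph (Fin n) → Matrix n
  degreeMatrix      G i j = if does (i Fin.≟ j) then degree G i · 1# else 0#
  adjacencyMatrix   G i j = if adj G i j then 1# else 0#
  signlessLaplacian G i j = degreeMatrix G i j + adjacencyMatrix G i j

  SignlessLaplacianCount : ∀ {n ℓ} → Graph (Fin n) → Pred Carrier ℓ → ℕ → Set (c ⊔ ℓ₁ ⊔ ℓ₂ ⊔ ℓ)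
  SignlessLaplacianCount G I m = EigenvalueCount (signlessLaplacian G) I m

{-# OPTIONS --safe #-}
module Submission where

-- The signless Laplacian form is Q(x) = Σ (x_u + x_v)² over the edges uv, so
-- m_G[0,1) ≤ k as soon as Q(x) ≥ |x|² holds on the common kernel of k linear
-- forms.  If the coordinates in a dominating set Z vanish, an edge from v to Z
-- contributes x_v², which gives k = |Z|.  In a maximum matching the endpoint
-- ("centre") of each edge can be chosen so that the centres dominate, whence
-- k = ν.  To save one form we use a smaller dominating set, or keep alive
--   * a triangle, where (a+b)² + (a+c)² + (b+c)² ≥ a² + b² + c²;
--   * two centres a, b with a common neighbour, on the kernel of x_a + x_b;
--   * a "house", a path a - l - l′ - b between two centres together with a
--     third centre sharing a neighbour with a: on x_a = x_b the path behaves
--     like a triangle, and x_a plus the third coordinate is set to 0.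
-- If neither these nor an augmenting path exist, the matched edges come in
-- pairs with a common unmatched vertex, each forming a component C₅.

open import Defs
open import Algebra.Bundles using (CommutativeRing)
import Algebra.Properties.Ring as RingProperties
import Algebra.Properties.Semiring.Sum as SemiringSum
import Algebra.Solver.CommutativeMonoid as CommutativeMonoidSolver
import Algebra.Solver.Ring.NaturalCoefficients.Default as SemiringSolver
open import Data.Bool.Base using (Bool; true; false; if_then_else_)
import Data.Bool.Properties as Bool
open import Data.Empty using (⊥; ⊥-elim)
open import Data.Fin.Base using (Fin; zero; suc; fromℕ<; punchIn; _↑ˡ_; _↑ʳ_; splitAt)
open import Data.Fin.Patterns
import Data.Fin.Properties as Fin
open import Data.Fin.Subset using (_⊆_; ∣_∣; ⁅_⁆)
open import Data.Fin.Subset.Properties using (p⊆q⇒∣p∣≤∣q∣; ∣⁅x⁆∣≡1; x∈⁅x⁆)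
open import Data.List.Base as List
  using (List; []; _∷_; [_]; _++_; length; allFin; map; drop; lookup; concatMap)
open import Data.List.Membership.Propositional using (_∈_; _∉_; find; lose)
open import Data.List.Membership.Propositional.Properties
  using (∈-allFin; ∈-++⁻; ∈-++⁺ˡ; ∈-++⁺ʳ; ∈-∃++; ∈-map⁻; ∈-map⁺; ∈-lookup; ∈-tabulate⁺; ∈-tabulate⁻)
open import Data.List.Properties using (length-++; length-map; length-tabulate; map-++; tabulate-lookup)
open import Data.List.Relation.Binary.Permutation.Propositional as ↭
  using (_↭_; prep; swap; ↭-refl; ↭-sym; ↭-trans; ↭⇒↭ₛ)
open import Data.List.Relation.Binary.Permutation.Propositional.Properties
  using (All-resp-↭; ∈-resp-↭; map⁺; ++⁺; ++⁺ʳ; ++⁺ˡ; ++-assoc; ++-comm; ++-identityʳ; shift; ↭-length;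
         ++-commutativeMonoid)
import Data.List.Relation.Binary.Permutation.Setoid.Properties as ↭ₛ
open import Data.List.Relation.Unary.All as All using (All; []; _∷_)
import Data.List.Relation.Unary.All.Properties as All
open import Data.List.Relation.Unary.AllPairs using (AllPairs; []; _∷_)
open import Data.List.Relation.Unary.Any using (Any; here; there; any?)
open import Data.List.Relation.Unary.Unique.Propositional using (Unique)
import Data.List.Relation.Unary.Unique.Propositional.Properties as Unique
open import Data.Nat.Base as ℕ using (ℕ; zero; suc)
import Data.Nat.Properties as ℕ
open import Data.Product.Base using (∃-syntax; _×_; _,_; proj₁; proj₂)
open import Data.Sum.Base using (_⊎_; inj₁; inj₂; [_,_]′)
open import Data.Vec.Base using (tabulate)
open import Data.Vec.Functional using (Vector; insertAt)
open import Data.Vec.Functional.Properties using (insertAt-lookup; insertAt-punchIn)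
open import Data.Vec.Properties using ([]=⇒lookup; lookup∘tabulate)
open import Function.Base using (_∘_; id)
open import Function.Bundles using (Equivalence; Inverse; mk↔ₛ′)
open import Relation.Binary.PropositionalEquality as ≡ using (_≡_; _≢_; refl)
open import Relation.Binary.Structures using (IsStrictPartialOrder)
open import Relation.Nullary.Decidable
  using (Dec; yes; no; does; from-yes; ¬?; _×-dec_; _→-dec_; _⊎-dec_)
open import Relation.Nullary.Negation using (¬_; contradiction)

-- The exception is forced: `C₅` has eigenvalues 4, (3+√5)/2 twice and (3-√5)/2 twice, hence two
-- below 1, and its matching number is 2. On a pentagon no form can be saved.
--
-- The obstacle elsewhere is that the single form x_a + x_b, unlike the two forms x_a and x_b, does
-- not control a vertex that sees only one of a and b. Minimum degree 2 supplies each such vertex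
-- with a second neighbour, and the case distinctions follow where that neighbour lies: another
-- centre, another leaf, or an unmatched vertex.
--
-- The combinatorial part assumes that every certificate has at least ν forms. Each configuration
-- ruled out there yields a certificate with fewer forms or a matching with more than ν edges. The
-- real numbers enter only in showing that a certificate bounds the count. Their order is not
-- decidable, but inequalities between reals are negations and the conclusion compares natural
-- numbers, so case distinctions are harmless under a double negation.

module Certificates {n} (G : Graph (Fin n)) where

  infix 4 _~_

  _~_ : Fin n → Fin n → Set
  u ~ v = adj G u v ≡ true

  -- Core vs forms: a pair (a , b) among the forms stands for x_a + x_b, and on
  -- the common kernel the edges within vs contribute at least Σ x_v² over vs.
  data Core : List (Fin n) → List (Fin n × Fin n) → Set where
    none     : Core [] []
    triangle : ∀ {a b c} → a ~ b → a ~ c → b ~ c → Core (a ∷ b ∷ c ∷ []) []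
    cherry   : ∀ {l a b} → l ~ a → l ~ b → Core (l ∷ a ∷ b ∷ []) ((a , b) ∷ [])
    house    : ∀ {lᵢ lₖ lⱼ cᵢ cₖ cⱼ} →
               lᵢ ~ lₖ → lᵢ ~ cᵢ → lₖ ~ cₖ → lⱼ ~ cᵢ → lⱼ ~ cⱼ →
               Core (lᵢ ∷ lₖ ∷ lⱼ ∷ cᵢ ∷ cₖ ∷ cⱼ ∷ []) ((cᵢ , cⱼ) ∷ (cₖ , cⱼ) ∷ [])

  Joins : Fin n → Fin n × Fin n → Set
  Joins v (a , b) = v ~ a × v ~ b

  -- The split keeps every edge from being charged twice: a vertex of `rest` is paid for by its
  -- edges to `core ++ zeros`, the core by the edges inside it, and `zeros` need no payment since
  -- their coordinates vanish.
  record Certificate : Set where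
    field
      {rest core zeros} : List (Fin n)
      {pairs}           : List (Fin n × Fin n)
      isCore            : Core core pairs
      partition         : rest ++ core ++ zeros ↭ allFin n
      covered           : All (λ v → Any (v ~_) zeros ⊎ Any (Joins v) pairs) rest

    size : ℕ
    size = length pairs ℕ.+ length zeros

-- Inequalities in an ordered field without decidable order.

module Order {c ℓ₁ ℓ₂} (ℝ : RealNumbers c ℓ₁ ℓ₂) where
  open RealNumbers ℝ public hiding (zero)
  open CommutativeRing commutativeRing public
    using (sym; trans; reflexive; ring; semiring; commutativeSemiring)
    renaming (refl to ≈-refl)
  open IsStrictPartialOrder isStrictPartialOrder public
    using (<-resp-≈; <-respʳ-≈; <-respˡ-≈)
    renaming (irrefl to <-irrefl; trans to <-trans)
  open SemiringSolver commutativeSemiring public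
    using (solve; _:=_; _:+_; _:*_; con)

  -- Tightness of apartness gives trichotomy under a double negation. Since `_≤_` is itself a
  -- negation, that suffices wherever a case distinction is needed to prove an inequality.
  ≈⊎<⊎> : ∀ x y → ¬ ¬ (x ≈ y ⊎ (x < y ⊎ y < x))
  ≈⊎<⊎> x y k = k (inj₁ (proj₁ (tight x y) λ x#y →
    k (inj₂ (Equivalence.to (#⇔<⊎> x y) x#y))))

  ≤-reflexive : ∀ {x y} → x ≈ y → x ≤ y
  ≤-reflexive x≈y y<x = <-irrefl (sym x≈y) y<x

  ≤-refl : ∀ {x} → x ≤ x
  ≤-refl = ≤-reflexive ≈-refl

  <⇒≤ : ∀ {x y} → x < y → x ≤ y
  <⇒≤ x<y y<x = <-irrefl ≈-refl (<-trans x<y y<x)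

  ≤-trans : ∀ {x y z} → x ≤ y → y ≤ z → x ≤ z
  ≤-trans {x} {y} {z} x≤y y≤z z<x = ≈⊎<⊎> y z λ
    { (inj₁ y≈z)        → x≤y (<-respˡ-≈ (sym y≈z) z<x)
    ; (inj₂ (inj₁ y<z)) → x≤y (<-trans y<z z<x)
    ; (inj₂ (inj₂ z<y)) → y≤z z<y
    }

  ≤-resp₂ : ∀ {x x′ y y′} → x ≈ x′ → y ≈ y′ → x ≤ y → x′ ≤ y′
  ≤-resp₂ p q x≤y = ≤-trans (≤-reflexive (sym p)) (≤-trans x≤y (≤-reflexive q))

  private
    -z+[z+x]≈x : ∀ z x → - z + (z + x) ≈ x
    -z+[z+x]≈x z x = trans (sym (+-assoc (- z) z x))
      (trans (+-cong (-‿inverseˡ z) ≈-refl) (+-identityˡ x))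

  +-cancelˡ-< : ∀ z {x y} → z + x < z + y → x < y
  +-cancelˡ-< z {x} {y} lt =
    <-respˡ-≈ (-z+[z+x]≈x z x) (<-respʳ-≈ (-z+[z+x]≈x z y) (+-monoʳ-< (- z) lt))

  +-monoʳ-≤ : ∀ z {x y} → x ≤ y → z + x ≤ z + y
  +-monoʳ-≤ z x≤y = x≤y ∘ +-cancelˡ-< z

  +-mono-≤ : ∀ {x y u v} → x ≤ y → u ≤ v → x + u ≤ y + v
  +-mono-≤ {x} {y} {u} {v} x≤y u≤v = ≤-trans (+-monoʳ-≤ x u≤v)
    (≤-resp₂ (+-comm v x) (+-comm v y) (+-monoʳ-≤ v x≤y))

  0≤x+y : ∀ {x y} → 0# ≤ x → 0# ≤ y → 0# ≤ x + y
  0≤x+y 0≤x 0≤y = ≤-resp₂ (+-identityˡ 0#) ≈-refl (+-mono-≤ 0≤x 0≤y)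

  x≤x+y : ∀ {x y} → 0# ≤ y → x ≤ x + y
  x≤x+y {x} 0≤y = ≤-resp₂ (+-identityʳ x) ≈-refl (+-monoʳ-≤ x 0≤y)

  y≤x+y : ∀ {x y} → 0# ≤ x → y ≤ x + y
  y≤x+y {x} {y} 0≤x = ≤-resp₂ ≈-refl (+-comm y x) (x≤x+y 0≤x)

  +-mono-< : ∀ {x y u v} → x < y → u < v → x + u < y + v
  +-mono-< {x} {y} {u} {v} x<y u<v = <-trans (+-monoʳ-< x u<v)
    (<-respˡ-≈ (+-comm v x) (<-respʳ-≈ (+-comm v y) (+-monoʳ-< v x<y)))

  halve-≤ : ∀ {x y} → x + x ≤ y + y → x ≤ y
  halve-≤ 2x≤2y y<x = 2x≤2y (+-mono-< y<x y<x)

  0<-x : ∀ {x} → x < 0# → 0# < - x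
  0<-x {x} x<0 = <-respˡ-≈ (-‿inverseˡ x) (<-respʳ-≈ (+-identityʳ (- x)) (+-monoʳ-< (- x) x<0))

  0<y-x : ∀ {x y} → x < y → 0# < y - x
  0<y-x {x} {y} x<y = <-respˡ-≈ (-‿inverseˡ x) (<-respʳ-≈ (+-comm (- x) y) (+-monoʳ-< (- x) x<y))

  open RingProperties ring public
    using (-‿distribˡ-*; -‿distribʳ-*; -‿involutive; -0#≈0#)

  -x*-x≈x*x : ∀ x → - x * - x ≈ x * x
  -x*-x≈x*x x = trans (sym (-‿distribˡ-* x (- x)))
    (trans (-‿cong (sym (-‿distribʳ-* x x))) (-‿involutive (x * x)))

  #0⇒0<x*x : ∀ {x} → x # 0# → 0# < x * x
  #0⇒0<x*x {x} x#0 with Equivalence.to (#⇔<⊎> x 0#) x#0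
  ... | inj₁ x<0 = <-respʳ-≈ (-x*-x≈x*x x) (*-pos (0<-x x<0) (0<-x x<0))
  ... | inj₂ 0<x = *-pos 0<x 0<x

  0≤x*x : ∀ x → 0# ≤ x * x
  0≤x*x x x*x<0 = ≈⊎<⊎> x 0# λ
    { (inj₁ x≈0) → <-irrefl (trans (*-cong x≈0 ≈-refl) (zeroˡ x)) x*x<0
    ; (inj₂ p)   → <⇒≤ (#0⇒0<x*x (Equivalence.from (#⇔<⊎> x 0#) p)) x*x<0
    }

  x*x≤0⇒x≈0 : ∀ {x} → x * x ≤ 0# → x ≈ 0#
  x*x≤0⇒x≈0 {x} x*x≤0 = proj₁ (tight x 0#) (x*x≤0 ∘ #0⇒0<x*x)

-- List sums and the sum-of-squares identities behind the cores.

module Sums {c ℓ₁ ℓ₂} (ℝ : RealNumbers c ℓ₁ ℓ₂) where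
  open Order ℝ

  ∑ : ∀ {A : Set} → (A → Carrier) → List A → Carrier
  ∑ f []       = 0#
  ∑ f (v ∷ vs) = f v + ∑ f vs

  sq : Carrier → Carrier
  sq a = a * a

  module _ {A : Set} (f : A → Carrier) where

    ∑-++ : ∀ xs ys → ∑ f (xs ++ ys) ≈ ∑ f xs + ∑ f ys
    ∑-++ []       ys = sym (+-identityˡ _)
    ∑-++ (x ∷ xs) ys = trans (+-cong ≈-refl (∑-++ xs ys)) (sym (+-assoc _ _ _))

    ∑-↭ : ∀ {xs ys} → xs ↭ ys → ∑ f xs ≈ ∑ f ys
    ∑-↭ ↭.refl        = ≈-refl
    ∑-↭ (prep x p)    = +-cong ≈-refl (∑-↭ p)
    ∑-↭ (swap x y p)  = trans (sym (+-assoc _ _ _))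
      (trans (+-cong (+-comm _ _) (∑-↭ p)) (+-assoc _ _ _))
    ∑-↭ (↭.trans p q) = trans (∑-↭ p) (∑-↭ q)

    module _ (0≤f : ∀ v → 0# ≤ f v) where

      0≤∑ : ∀ xs → 0# ≤ ∑ f xs
      0≤∑ []       = ≤-refl
      0≤∑ (x ∷ xs) = 0≤x+y (0≤f x) (0≤∑ xs)

      term≤∑ : ∀ {P : A → Set} {b xs} → (∀ {v} → P v → b ≤ f v) → Any P xs → b ≤ ∑ f xs
      term≤∑ {xs = _ ∷ xs} g (here p)  = ≤-trans (g p) (x≤x+y (0≤∑ xs))
      term≤∑ g (there i) = ≤-trans (term≤∑ g i) (y≤x+y (0≤f _))

      pair≤∑ : ∀ {a b ys xs} → a ∷ b ∷ ys ↭ xs → f a + f b ≤ ∑ f xs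
      pair≤∑ {a} {b} {ys} p = ≤-trans (x≤x+y (0≤∑ ys))
        (≤-reflexive (trans (+-assoc _ _ _) (∑-↭ p)))

  ∑-cong : ∀ {A : Set} {f g : A → Carrier} → (∀ v → f v ≈ g v) → ∀ xs → ∑ f xs ≈ ∑ g xs
  ∑-cong f≈g []       = ≈-refl
  ∑-cong f≈g (x ∷ xs) = +-cong (f≈g x) (∑-cong f≈g xs)

  ∑-distrib-+ : ∀ {A : Set} (f g : A → Carrier) xs → ∑ (λ v → f v + g v) xs ≈ ∑ f xs + ∑ g xs
  ∑-distrib-+ f g []       = sym (+-identityˡ _)
  ∑-distrib-+ f g (x ∷ xs) = trans (+-cong ≈-refl (∑-distrib-+ f g xs))
    (solve 4 (λ a b c d → (a :+ b) :+ (c :+ d) := (a :+ c) :+ (b :+ d)) ≈-refl _ _ _ _)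

  triangle-identity : ∀ a b c →
    sq (a + b) + (sq (a + c) + sq (b + c)) ≈ (sq a + (sq b + sq c)) + sq (a + b + c)
  triangle-identity = solve 3 (λ a b c →
    (a :+ b) :* (a :+ b) :+ ((a :+ c) :* (a :+ c) :+ (b :+ c) :* (b :+ c)) :=
    (a :* a :+ (b :* b :+ c :* c)) :+ (a :+ b :+ c) :* (a :+ b :+ c)) ≈-refl

  cherry-identity : ∀ l {a b} → a + b ≈ 0# →
    sq (l + a) + sq (l + b) ≈ (sq l + (sq a + sq b)) + sq l
  cherry-identity l {a} {b} a+b≈0 = trans
    (solve 3 (λ l a b →
      (l :+ a) :* (l :+ a) :+ (l :+ b) :* (l :+ b) :=
      ((l :* l :+ (a :* a :+ b :* b)) :+ l :* l) :+ (l :+ l) :* (a :+ b)) ≈-refl l a b)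
    (trans (+-cong ≈-refl (trans (*-cong ≈-refl a+b≈0) (zeroʳ _))) (+-identityʳ _))

-- The signless Laplacian form and its lower bound on a certificate.

module QuadraticForm {c ℓ₁ ℓ₂} (ℝ : RealNumbers c ℓ₁ ℓ₂) {n} (G : Graph (Fin n)) where
  open Order ℝ
  open Sums ℝ
  open Certificates G

  module _ (x : Fin n → Carrier) where

    weight : Fin n → Fin n → Carrier
    weight u v = if adj G u v then sq (x u + x v) else 0#

    -- Q xs is the quadratic form of the subgraph induced on xs.
    Q : List (Fin n) → Carrier
    Q []       = 0#
    Q (v ∷ vs) = ∑ (weight v) vs + Q vs

    normSq : List (Fin n) → Carrier
    normSq = ∑ (λ v → sq (x v))

    0≤weight : ∀ u v → 0# ≤ weight u v
    0≤weight u v with adj G u v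
    ... | true  = 0≤x*x _
    ... | false = ≤-refl

    0≤Q : ∀ vs → 0# ≤ Q vs
    0≤Q []       = ≤-refl
    0≤Q (v ∷ vs) = 0≤x+y (0≤∑ _ (0≤weight v) vs) (0≤Q vs)

    ~⇒weight : ∀ {u v} → u ~ v → weight u v ≈ sq (x u + x v)
    ~⇒weight u~v rewrite u~v = ≈-refl

    weight-sym : ∀ u v → weight u v ≈ weight v u
    weight-sym u v rewrite adj-sym G u v with adj G v u
    ... | true  = *-cong (+-comm _ _) (+-comm _ _)
    ... | false = ≈-refl

    weight-irrefl : ∀ v → weight v v ≈ 0#
    weight-irrefl v rewrite adj-irrefl G v = ≈-refl

    ∑∑≈Q+Q : ∀ vs → ∑ (λ u → ∑ (weight u) vs) vs ≈ Q vs + Q vs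
    ∑∑≈Q+Q []       = sym (+-identityˡ _)
    ∑∑≈Q+Q (v ∷ vs) = trans
      (+-cong (+-cong (weight-irrefl v) ≈-refl)
        (trans (∑-distrib-+ (λ u → weight u v) (λ u → ∑ (weight u) vs) vs)
          (+-cong (∑-cong (λ u → weight-sym u v) vs) (∑∑≈Q+Q vs))))
      (trans (+-cong (+-identityˡ _) ≈-refl)
        (solve 2 (λ r q → r :+ (r :+ (q :+ q)) := (r :+ q) :+ (r :+ q)) ≈-refl _ _))

    -- `Q` charges an edge to whichever endpoint comes first, so its recursion depends on the order
    -- of the list. The full double sum does not, and it meets each edge from both ends; hence the
    -- doubled statement, halved again by `halve-≤`.
    Q-↭ : ∀ {us vs} → us ↭ vs → Q us + Q us ≈ Q vs + Q vs
    Q-↭ {us} {vs} p = trans (sym (∑∑≈Q+Q us)) (trans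
      (trans (∑-cong (λ u → ∑-↭ (weight u) p) us) (∑-↭ _ p)) (∑∑≈Q+Q vs))

    Q-++ : ∀ us vs → Q us ≤ Q (us ++ vs)
    Q-++ []       vs = 0≤Q vs
    Q-++ (u ∷ us) vs = +-mono-≤
      (≤-trans (x≤x+y (0≤∑ _ (0≤weight u) vs)) (≤-reflexive (sym (∑-++ (weight u) us vs))))
      (Q-++ us vs)

    -- Edges from `us` to `vs` pay for `us`, edges inside `vs` remain for `Q vs`, and edges inside
    -- `us` are dropped as nonnegative.
    rows≤Q : ∀ us vs → All (λ u → sq (x u) ≤ ∑ (weight u) vs) us →
             normSq us + Q vs ≤ Q (us ++ vs)
    rows≤Q []       vs []       = ≤-reflexive (+-identityˡ _)
    rows≤Q (u ∷ us) vs (p ∷ ps) = ≤-trans (≤-reflexive (+-assoc _ _ _)) (+-mono-≤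
      (≤-trans p (≤-trans (y≤x+y (0≤∑ _ (0≤weight u) us))
        (≤-reflexive (sym (∑-++ (weight u) us vs)))))
      (rows≤Q us vs ps))

    Cancels : Fin n × Fin n → Set ℓ₁
    Cancels (a , b) = x a + x b ≈ 0#

    private
      pair≤row : ∀ {v a b xs} ys → v ~ a → v ~ b → a ∷ b ∷ ys ↭ xs →
                 sq (x v + x a) + sq (x v + x b) ≤ ∑ (weight v) xs
      pair≤row {v} ys v~a v~b p = ≤-trans
        (≤-reflexive (sym (+-cong (~⇒weight v~a) (~⇒weight v~b))))
        (pair≤∑ (weight v) (0≤weight v) p)

      edge≤row : ∀ {v a xs} → v ~ a → Any (a ≡_) xs → sq (x v + x a) ≤ ∑ (weight v) xs
      edge≤row {v} v~a = term≤∑ (weight v) (0≤weight v)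
        λ { refl → ≤-reflexive (sym (~⇒weight v~a)) }

      joins≤row : ∀ {v a b xs} ys → v ~ a → v ~ b → Cancels (a , b) → a ∷ b ∷ ys ↭ xs →
                  sq (x v) ≤ ∑ (weight v) xs
      joins≤row {v} {a} {b} ys v~a v~b ab p = ≤-trans
        (≤-trans (y≤x+y (0≤x+y (0≤x*x _) (0≤x+y (0≤x*x _) (0≤x*x _))))
          (≤-reflexive (sym (cherry-identity (x v) ab))))
        (pair≤row ys v~a v~b p)

    core≤Q : ∀ {core pairs} → Core core pairs → All Cancels pairs → normSq core ≤ Q core
    core≤Q none [] = ≤-refl
    core≤Q (triangle {a} {b} {c} a~b a~c b~c) [] = ≤-trans
      (≤-trans (x≤x+y (0≤x*x _)) (≤-reflexive (trans
        (+-cong (+-cong ≈-refl (+-cong ≈-refl (+-identityʳ _))) ≈-refl)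
        (trans (sym (triangle-identity (x a) (x b) (x c))) (sym (+-assoc _ _ _))))))
      (+-mono-≤ (pair≤row [] a~b a~c ↭.refl)
        (≤-trans (edge≤row {xs = c ∷ []} b~c (here refl)) (x≤x+y (0≤Q (c ∷ [])))))
    core≤Q (cherry {l} {a} {b} l~a l~b) (ab ∷ []) = ≤-trans
      (≤-trans (x≤x+y (0≤x*x _)) (≤-reflexive (trans
        (+-cong (+-cong ≈-refl (+-cong ≈-refl (+-identityʳ _))) ≈-refl)
        (sym (cherry-identity (x l) ab)))))
      (≤-trans (pair≤row [] l~a l~b ↭.refl) (x≤x+y (0≤Q (a ∷ b ∷ []))))
    -- Both forms involve cⱼ, so cᵢ and cₖ carry equal values and the edge lₖcₖ weighs as much as an
    -- edge lₖcᵢ would. The triangle on lᵢ, lₖ, cᵢ pays for cᵢ once and the cherry at lⱼ pays for it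
    -- again; the second payment is the one owed to cₖ.
    core≤Q (house {lᵢ} {lₖ} {lⱼ} {cᵢ} {cₖ} {cⱼ} lᵢ~lₖ lᵢ~cᵢ lₖ~cₖ lⱼ~cᵢ lⱼ~cⱼ) (ij ∷ kj ∷ []) =
      ≤-trans
        (≤-trans (x≤x+y (0≤x+y (0≤x*x (i + k + cᵢ′)) (0≤x*x j)))
          (≤-reflexive (trans regroup (sym (+-cong (triangle-identity i k cᵢ′) (cherry-identity j ij))))))
        (≤-trans (≤-reflexive reassociate)
        (+-mono-≤ (pair≤row (lⱼ ∷ cₖ ∷ cⱼ ∷ []) lᵢ~lₖ lᵢ~cᵢ
            (prep lₖ (swap cᵢ lⱼ ↭.refl)))
          (+-mono-≤ (edge≤row {xs = lⱼ ∷ cᵢ ∷ cₖ ∷ cⱼ ∷ []} lₖ~cₖ (there (there (here refl))))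
            (≤-trans (pair≤row (cₖ ∷ []) lⱼ~cᵢ lⱼ~cⱼ (prep cᵢ (swap cⱼ cₖ ↭.refl)))
              (x≤x+y (0≤Q (cᵢ ∷ cₖ ∷ cⱼ ∷ [])))))))
      where
      i = x lᵢ
      k = x lₖ
      j = x lⱼ
      cᵢ′ = x cᵢ
      cₖ′ = x cₖ
      cⱼ′ = x cⱼ

      cᵢ≈cₖ : cᵢ′ ≈ cₖ′
      cᵢ≈cₖ = trans (sym (+-identityʳ _)) (trans (+-cong ≈-refl (sym (trans (+-comm _ _) kj)))
        (trans (sym (+-assoc _ _ _)) (trans (+-cong ij ≈-refl) (+-identityˡ _))))

      regroup : sq i + (sq k + (sq j + (sq cᵢ′ + (sq cₖ′ + (sq cⱼ′ + 0#)))))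
                  + (sq (i + k + cᵢ′) + sq j)
                ≈ ((sq i + (sq k + sq cᵢ′)) + sq (i + k + cᵢ′)) + ((sq j + (sq cᵢ′ + sq cⱼ′)) + sq j)
      regroup = trans
        (+-cong (+-cong ≈-refl (+-cong ≈-refl (+-cong ≈-refl (+-cong ≈-refl
          (+-cong (*-cong (sym cᵢ≈cₖ) (sym cᵢ≈cₖ)) (+-identityʳ _)))))) ≈-refl)
        (solve 6 (λ i k j c d e →
          i :+ (k :+ (j :+ (c :+ (c :+ d)))) :+ (e :+ j) :=
          ((i :+ (k :+ c)) :+ e) :+ ((j :+ (c :+ d)) :+ j)) ≈-refl
          (sq i) (sq k) (sq j) (sq cᵢ′) (sq cⱼ′) (sq (i + k + cᵢ′)))

      reassociate : (sq (i + k) + (sq (i + cᵢ′) + sq (k + cᵢ′))) + (sq (j + cᵢ′) + sq (j + cⱼ′))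
                    ≈ (sq (i + k) + sq (i + cᵢ′)) + (sq (k + cₖ′) + (sq (j + cᵢ′) + sq (j + cⱼ′)))
      reassociate = trans
        (+-cong (+-cong ≈-refl (+-cong ≈-refl
          (*-cong (+-cong ≈-refl cᵢ≈cₖ) (+-cong ≈-refl cᵢ≈cₖ)))) ≈-refl)
        (solve 4 (λ a b c d → (a :+ (b :+ c)) :+ d := (a :+ b) :+ (c :+ d)) ≈-refl _ _ _ _)

    module _ {core pairs zeros} (isCore : Core core pairs)
             (cancels : All Cancels pairs) (vanishes : All (λ z → x z ≈ 0#) zeros) where

      private
        zero-row : ∀ {v zs} → All (λ z → x z ≈ 0#) zs → Any (v ~_) zs → sq (x v) ≤ ∑ (weight v) zs
        zero-row {v} {z ∷ zs} (x≈0 ∷ _) (here v~z) = ≤-trans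
          (≤-reflexive (sym (trans (~⇒weight v~z) (*-cong x+0 x+0))))
          (x≤x+y (0≤∑ _ (0≤weight v) zs))
          where x+0 = trans (+-cong ≈-refl x≈0) (+-identityʳ _)
        zero-row {v} {z ∷ _} (_ ∷ vz) (there i) = ≤-trans (zero-row vz i) (y≤x+y (0≤weight v z))

        pair-row : ∀ {v core pairs} → Core core pairs → All Cancels pairs → Any (Joins v) pairs →
                   sq (x v) ≤ ∑ (weight v) core
        pair-row (cherry {l} {a} {b} _ _) (ab ∷ []) (here (v~a , v~b)) =
          joins≤row (l ∷ []) v~a v~b ab
            (↭.trans (prep a (swap b l ↭.refl)) (swap a l ↭.refl))
        pair-row (house {lᵢ} {lₖ} {lⱼ} {cᵢ} {cₖ} {cⱼ} _ _ _ _ _) (ij ∷ _) (here (v~a , v~b)) =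
          joins≤row (cₖ ∷ lᵢ ∷ lₖ ∷ lⱼ ∷ []) v~a v~b ij (↭.trans
            (prep cᵢ (swap cⱼ cₖ ↭.refl)) (++-comm (cᵢ ∷ cₖ ∷ cⱼ ∷ []) (lᵢ ∷ lₖ ∷ lⱼ ∷ [])))
        pair-row (house {lᵢ} {lₖ} {lⱼ} {cᵢ} {cₖ} {cⱼ} _ _ _ _ _) (_ ∷ kj ∷ _) (there (here (v~a , v~b))) =
          joins≤row (cᵢ ∷ lᵢ ∷ lₖ ∷ lⱼ ∷ []) v~a v~b kj (↭.trans
            (↭.trans (prep cₖ (swap cⱼ cᵢ ↭.refl)) (swap cₖ cᵢ ↭.refl))
            (++-comm (cᵢ ∷ cₖ ∷ cⱼ ∷ []) (lᵢ ∷ lₖ ∷ lⱼ ∷ [])))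
        pair-row (house _ _ _ _ _) _ (there (there ()))

        covered-row : ∀ {v} → Any (v ~_) zeros ⊎ Any (Joins v) pairs →
                      sq (x v) ≤ ∑ (weight v) (core ++ zeros)
        covered-row {v} i = ≤-trans
          ([ (λ j → ≤-trans (zero-row vanishes j) (y≤x+y (0≤∑ _ (0≤weight v) core)))
           , (λ j → ≤-trans (pair-row isCore cancels j) (x≤x+y (0≤∑ _ (0≤weight v) zeros))) ]′ i)
          (≤-reflexive (sym (∑-++ (weight v) core zeros)))

        normSq-zeros : ∀ {zs} → All (λ z → x z ≈ 0#) zs → normSq zs ≈ 0#
        normSq-zeros []       = ≈-refl
        normSq-zeros (p ∷ ps) = trans (+-cong (trans (*-cong p ≈-refl) (zeroˡ _)) (normSq-zeros ps))
          (+-identityˡ _)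

      normSq≤Q : ∀ {rest} → rest ++ core ++ zeros ↭ allFin n →
                 All (λ v → Any (v ~_) zeros ⊎ Any (Joins v) pairs) rest →
                 normSq (allFin n) + normSq (allFin n) ≤ Q (allFin n) + Q (allFin n)
      normSq≤Q {rest} partition covered = ≤-resp₂
        (+-cong norm-eq norm-eq) (Q-↭ partition) (+-mono-≤ bound bound)
        where
        norm-eq : normSq rest + normSq core ≈ normSq (allFin n)
        norm-eq = trans (+-cong ≈-refl (sym (trans (+-cong ≈-refl (normSq-zeros vanishes)) (+-identityʳ _))))
          (trans (+-cong ≈-refl (sym (∑-++ _ core zeros)))
            (trans (sym (∑-++ _ rest (core ++ zeros))) (∑-↭ _ partition)))

        bound : normSq rest + normSq core ≤ Q (rest ++ core ++ zeros)
        bound = ≤-trans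
          (+-monoʳ-≤ _ (≤-trans (core≤Q isCore cancels) (Q-++ core zeros)))
          (rows≤Q rest (core ++ zeros) (All.map covered-row covered))

-- Sums over `Fin`, and kernels of wide linear systems.

module FinSums {c ℓ₁ ℓ₂} (ℝ : RealNumbers c ℓ₁ ℓ₂) where
  open Order ℝ
  open Sums ℝ using (∑; sq)
  open SemiringSum semiring public
    using (∑-distrib-+; ∑-comm; *-distribˡ-sum; *-distribʳ-sum; sum-remove)
    renaming (sum-cong-≋ to sum-cong)

  ∑-tabulate : ∀ {A : Set} {n} (f : A → Carrier) (g : Fin n → A) →
               ∑ f (List.tabulate g) ≡ sum (f ∘ g)
  ∑-tabulate {n = zero}  f g = refl
  ∑-tabulate {n = suc n} f g = ≡.cong (f (g zero) +_) (∑-tabulate f (g ∘ suc))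

  sum-zero : ∀ {n} {t : Vector Carrier n} → (∀ i → t i ≈ 0#) → sum t ≈ 0#
  sum-zero {zero}  t≈0 = ≈-refl
  sum-zero {suc n} t≈0 = trans (+-cong (t≈0 zero) (sum-zero (t≈0 ∘ suc))) (+-identityˡ 0#)

  sum-single : ∀ {n} (t : Vector Carrier n) k → (∀ l → k ≢ l → t l ≈ 0#) → sum t ≈ t k
  sum-single {suc n} t k off = trans (sum-remove {i = k} t)
    (trans (+-cong ≈-refl (sum-zero λ i → off (punchIn k i) (Fin.punchInᵢ≢i k i ∘ ≡.sym)))
      (+-identityʳ _))

  sum-↑ : ∀ m {n} (t : Vector Carrier (m ℕ.+ n)) →
          sum t ≈ sum (t ∘ (_↑ˡ n)) + sum (t ∘ (m ↑ʳ_))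
  sum-↑ zero    t = sym (+-identityˡ _)
  sum-↑ (suc m) t = trans (+-cong ≈-refl (sum-↑ m (t ∘ suc))) (sym (+-assoc _ _ _))

  sum-nonneg : ∀ {n} {t : Vector Carrier n} → (∀ i → 0# ≤ t i) → 0# ≤ sum t
  sum-nonneg {zero}  0≤t = ≤-refl
  sum-nonneg {suc n} 0≤t = 0≤x+y (0≤t zero) (sum-nonneg (0≤t ∘ suc))

  term≤sum : ∀ {n} {t : Vector Carrier n} → (∀ i → 0# ≤ t i) → ∀ i → t i ≤ sum t
  term≤sum 0≤t zero    = x≤x+y (sum-nonneg (0≤t ∘ suc))
  term≤sum 0≤t (suc i) = ≤-trans (term≤sum (0≤t ∘ suc) i) (y≤x+y (0≤t zero))

  sum-mono-≤ : ∀ {n} {s t : Vector Carrier n} → (∀ i → s i ≤ t i) → sum s ≤ sum t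
  sum-mono-≤ {zero}  s≤t = ≤-refl
  sum-mono-≤ {suc n} s≤t = +-mono-≤ (s≤t zero) (sum-mono-≤ (s≤t ∘ suc))

  sum-squeeze : ∀ {n} {s t : Vector Carrier n} → (∀ i → s i ≤ t i) → sum t ≤ sum s →
                ∀ i → t i ≤ s i
  sum-squeeze s≤t ∑t≤∑s zero s₀<t₀ = ≤-trans ∑t≤∑s
    (+-monoʳ-≤ _ (sum-mono-≤ (s≤t ∘ suc)))
    (<-respˡ-≈ (+-comm _ _) (<-respʳ-≈ (+-comm _ _) (+-monoʳ-< _ s₀<t₀)))
  sum-squeeze s≤t ∑t≤∑s (suc i) = sum-squeeze (s≤t ∘ suc)
    (λ s′<t′ → ≤-trans (+-mono-≤ (s≤t zero) ≤-refl) ∑t≤∑s (+-monoʳ-< _ s′<t′)) i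

  Nonzero : ∀ {n} → Vector Carrier n → Set ℓ₂
  Nonzero a = ∃[ p ] a p # 0#

  #⇒inverse : ∀ {a} → a # 0# → ∃[ b ] a * b + 1# ≈ 0#
  #⇒inverse {a} a#0 with #⇒invertible a#0
  ... | b , _ , ab≈1 = - b , trans
    (+-cong (trans (sym (-‿distribʳ-* a b)) (-‿cong (trans
      (*-cong (sym (trans (+-cong ≈-refl -0#≈0#) (+-identityʳ a))) ≈-refl) ab≈1))) ≈-refl)
    (-‿inverseˡ 1#)

  -- Gaussian elimination; the negation of an inverse is used, so that no
  -- subtraction occurs.
  kernel : ∀ {k m} → k ℕ.< m → (N : Fin k → Vector Carrier m) →
           ¬ ¬ (∃[ a ] Nonzero a × (∀ i → sum (λ p → a p * N i p) ≈ 0#))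
  kernel {zero} {suc m} _ N ¬ker = ¬ker ((λ _ → 1#) , (zero , 1#0) , λ ())
    where
    1#0 = invertible⇒# (1# , x-0 , trans (*-comm _ _) x-0)
      where x-0 = trans (*-identityˡ _) (trans (+-cong ≈-refl -0#≈0#) (+-identityʳ 1#))
  -- Whether the first row vanishes cannot be decided. Both alternatives are refuted: an entry apart
  -- from 0 is refuted by the second, so by tightness all entries are 0, which the first refutes.
  kernel {suc k} {suc m} k<m N ¬ker = row₀ (inj₁ λ p → proj₁ (tight _ _) λ p#0 → row₀ (inj₂ (p , p#0)))
    where
    row₀ : ¬ ((∀ p → N zero p ≈ 0#) ⊎ Nonzero (N zero))
    row₀ (inj₁ N₀≈0) = kernel (ℕ.<-trans (ℕ.n<1+n k) k<m) (N ∘ suc) λ (a , a#0 , aN) →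
      ¬ker (a , a#0 , λ
        { zero    → sum-zero (λ p → trans (*-cong ≈-refl (N₀≈0 p)) (zeroʳ (a p)))
        ; (suc i) → aN i })
    row₀ (inj₂ (j , Nⱼ#0)) with #⇒inverse Nⱼ#0
    ... | q , Nⱼq+1≈0 = kernel (ℕ.s<s⁻¹ k<m) N′ extend
      where
      N′ : Fin k → Vector Carrier m
      -- As q is minus the inverse of the pivot, this multiple of the first row clears column j.
      N′ i p = N (suc i) (punchIn j p) + q * N (suc i) j * N zero (punchIn j p)

      extend : ¬ (∃[ a ] Nonzero a × (∀ i → sum (λ p → a p * N′ i p) ≈ 0#))
      extend (a , (p , ap#0) , aN′) =
        ¬ker (b , (punchIn j p , ≡.subst (_# 0#) (≡.sym (insertAt-punchIn a j t p)) ap#0) , bN)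
        where
        s : Fin (suc k) → Vector Carrier m
        s i p = a p * N i (punchIn j p)

        S : Fin (suc k) → Carrier
        S i = sum (s i)

        -- The value of coordinate j that the first equation forces once the other coordinates are
        -- given by `a`.
        t = q * S zero
        b = insertAt a j t

        row : ∀ i → sum (λ p → b p * N i p) ≈ t * N i j + S i
        row i = trans (sum-remove {i = j} (λ p → b p * N i p)) (+-cong
          (*-cong (reflexive (insertAt-lookup a j t)) ≈-refl)
          (sum-cong λ p → *-cong (reflexive (insertAt-punchIn a j t p)) ≈-refl))

        bN : ∀ i → sum (λ p → b p * N i p) ≈ 0#
        bN zero = trans (row zero) (trans
          (trans (+-cong ≈-refl (sym (*-identityˡ _)))
            (solve 4 (λ q s n o → q :* s :* n :+ o :* s := (n :* q :+ o) :* s) ≈-refl _ _ _ _))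
          (trans (*-cong Nⱼq+1≈0 ≈-refl) (zeroˡ _)))
        bN (suc i) = trans (row (suc i)) (trans (trans
          (solve 4 (λ q s n s′ → q :* s :* n :+ s′ := s′ :+ q :* n :* s) ≈-refl
            q (S zero) (N (suc i) j) (S (suc i)))
          (trans (+-cong ≈-refl (*-distribˡ-sum (q * N (suc i) j) (s zero)))
            (trans (sym (∑-distrib-+ (s (suc i)) (λ p → q * N (suc i) j * s zero p)))
              (sum-cong λ p → solve 4 (λ a n c n₀ → a :* n :+ c :* (a :* n₀) := a :* (n :+ c :* n₀))
                ≈-refl (a p) (N (suc i) (punchIn j p)) (q * N (suc i) j) (N zero (punchIn j p))))))
          (aN′ i))

  -- Laying the eigenbases end to end lets the total multiplicity serve as the number of unknowns in
  -- `kernel`.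
  flatten : ∀ {a} {A : Set a} {r} (d : Fin r → ℕ) → (∀ k → Fin (d k) → A) → Fin (ℕΣ.sum d) → A
  flatten {r = suc r} d N p = [ N zero , flatten (d ∘ suc) (λ k → N (suc k)) ]′ (splitAt (d zero) p)

  embed : ∀ {r} (d : Fin r → ℕ) k → Fin (d k) → Fin (ℕΣ.sum d)
  embed d zero    j = j ↑ˡ ℕΣ.sum (d ∘ suc)
  embed d (suc k) j = d zero ↑ʳ embed (d ∘ suc) k j

  embed-surjective : ∀ {r} (d : Fin r → ℕ) p → ∃[ k ] ∃[ j ] embed d k j ≡ p
  embed-surjective {suc r} d p with splitAt (d zero) p in eq
  ... | inj₁ j = zero , j , Fin.splitAt⁻¹-↑ˡ eq
  ... | inj₂ q with embed-surjective (d ∘ suc) q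
  ...   | k , j , refl = suc k , j , Fin.splitAt⁻¹-↑ʳ eq

  sum-flatten : ∀ {r} (d : Fin r → ℕ) (a : Vector Carrier (ℕΣ.sum d)) (N : ∀ k → Fin (d k) → Carrier) →
                sum (λ p → a p * flatten d N p) ≈ sum (λ k → sum (λ j → a (embed d k j) * N k j))
  sum-flatten {zero}  d a N = ≈-refl
  sum-flatten {suc r} d a N = trans (sum-↑ (d zero) _) (+-cong
    (sum-cong λ j → *-cong (≈-refl {a (j ↑ˡ rest)}) (reflexive
      (≡.cong [ N zero , tail ]′ (Fin.splitAt-↑ˡ (d zero) j rest))))
    (trans (sum-cong λ p → *-cong (≈-refl {a (d zero ↑ʳ p)}) (reflexive
        (≡.cong [ N zero , tail ]′ (Fin.splitAt-↑ʳ (d zero) rest p))))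
      (sum-flatten (d ∘ suc) (a ∘ (d zero ↑ʳ_)) (λ k → N (suc k)))))
    where
    rest = ℕΣ.sum (d ∘ suc)
    tail = flatten (d ∘ suc) (λ k → N (suc k))

-- Orthogonality of eigenspaces and the Rayleigh quotient argument.

module Eigenvectors {c ℓ₁ ℓ₂} (ℝ : RealNumbers c ℓ₁ ℓ₂) where
  open Order ℝ
  open Sums ℝ using (∑; sq)
  open FinSums ℝ
  open Spectrum ℝ

  dot : ∀ {n} → Vector Carrier n → Vector Carrier n → Carrier
  dot x y = sum (λ i → x i * y i)

  Symmetric : ∀ {n} → Matrix n → Set ℓ₁
  Symmetric M = ∀ i j → M i j ≈ M j i

  superpose : ∀ {r n} → (Fin r → Vector Carrier n) → Vector Carrier n
  superpose y i = sum (λ k → y k i)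

  dot-superposeˡ : ∀ {r n} (y : Fin r → Vector Carrier n) z → dot (superpose y) z ≈ sum (λ k → dot (y k) z)
  dot-superposeˡ y z = trans (sum-cong λ i → *-distribʳ-sum (z i) (λ k → y k i))
    (∑-comm (λ i k → y k i * z i))

  dot-superposeʳ : ∀ {r n} z (y : Fin r → Vector Carrier n) → dot z (superpose y) ≈ sum (λ k → dot z (y k))
  dot-superposeʳ z y = trans (sum-cong λ i → *-distribˡ-sum (z i) (λ k → y k i))
    (∑-comm (λ i k → z i * y k i))

  dot-orthogonal : ∀ {r n} (y z : Fin r → Vector Carrier n) →
                   (∀ k l → k ≢ l → dot (y k) (z l) ≈ 0#) →
                   dot (superpose y) (superpose z) ≈ sum (λ k → dot (y k) (z k))
  dot-orthogonal y z orth = trans (dot-superposeˡ y (superpose z)) (sum-cong λ k →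
    trans (dot-superposeʳ (y k) z) (sum-single (λ l → dot (y k) (z l)) k (orth k)))

  module _ {n} {M : Matrix n} where

    *ᵥ-superpose : ∀ {r} (y : Fin r → Vector Carrier n) i →
                   (M *ᵥ superpose y) i ≈ superpose (λ k → M *ᵥ y k) i
    *ᵥ-superpose y i = dot-superposeʳ (M i) y

    combination∈Eigenspace : ∀ {d μ} a (b : Fin d → Vector Carrier n) →
      (∀ k → b k ∈Eigenspace[ M , μ ]) → combination a b ∈Eigenspace[ M , μ ]
    combination∈Eigenspace {μ = μ} a b eig i = trans
      (*ᵥ-superpose (λ k v → a k * b k v) i) (trans
      (sum-cong λ k → trans
        (sum-cong λ j → solve 3 (λ m a b → m :* (a :* b) := a :* (m :* b)) ≈-refl (M i j) (a k) (b k j))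
        (trans (sym (*-distribˡ-sum (a k) (λ j → M i j * b k j)))
          (trans (*-cong ≈-refl (eig k i))
            (solve 3 (λ a m b → a :* (m :* b) := m :* (a :* b)) ≈-refl (a k) μ (b k i)))))
      (sym (*-distribˡ-sum μ (λ k → a k * b k i))))

    module _ (M-sym : Symmetric M) where

      dot-*ᵥ : ∀ x y → dot x (M *ᵥ y) ≈ dot (M *ᵥ x) y
      dot-*ᵥ x y = trans (sum-cong λ i → *-distribˡ-sum (x i) (λ j → M i j * y j))
        (trans (∑-comm (λ i j → x i * (M i j * y j)))
          (sum-cong λ j → trans
            (sum-cong λ i → trans (*-cong ≈-refl (*-cong (M-sym i j) ≈-refl))
              (solve 3 (λ x m y → x :* (m :* y) := (m :* x) :* y) ≈-refl (x i) (M j i) (y j)))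
            (sym (*-distribʳ-sum (y j) (λ i → M j i * x i)))))

      dot-scaleʳ : ∀ {μ y} → y ∈Eigenspace[ M , μ ] → ∀ x → dot x (M *ᵥ y) ≈ μ * dot x y
      dot-scaleʳ {μ} {y} eig x = trans
        (sum-cong λ i → trans (*-cong ≈-refl (eig i))
          (solve 3 (λ x m y → x :* (m :* y) := m :* (x :* y)) ≈-refl (x i) μ (y i)))
        (sym (*-distribˡ-sum μ (λ i → x i * y i)))

      -- Symmetry gives (κ - μ)⟨x, y⟩ = 0, and apartness makes κ - μ invertible.
      orthogonal : ∀ {κ μ x y} → κ # μ → x ∈Eigenspace[ M , κ ] → y ∈Eigenspace[ M , μ ] →
                   dot x y ≈ 0#
      orthogonal {κ} {μ} {x} {y} κ#μ x-eig y-eig with #⇒invertible κ#μ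
      ... | b , b*δ≈1 , _ = trans (sym (*-identityˡ _)) (trans (*-cong (sym b*δ≈1) ≈-refl)
        (trans (*-assoc _ _ _) (trans (*-cong ≈-refl δd≈0) (zeroʳ b))))
        where
        κd≈μd : κ * dot x y ≈ μ * dot x y
        κd≈μd = trans (trans (*-cong ≈-refl (sum-cong λ i → *-comm (x i) (y i)))
            (sym (dot-scaleʳ x-eig y)))
          (trans (sum-cong λ i → *-comm (y i) ((M *ᵥ x) i))
            (trans (sym (dot-*ᵥ x y)) (dot-scaleʳ y-eig x)))

        δd≈0 : (κ - μ) * dot x y ≈ 0#
        δd≈0 = trans (distribʳ _ κ (- μ)) (trans
          (+-cong κd≈μd (sym (-‿distribˡ-* μ _))) (-‿inverseʳ _))

  dot≤0⇒≈0 : ∀ {n} {x : Vector Carrier n} → dot x x ≤ 0# → ∀ i → x i ≈ 0#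
  dot≤0⇒≈0 {x = x} xx≤0 i = x*x≤0⇒x≈0 (≤-trans (term≤sum (λ i → 0≤x*x (x i)) i) xx≤0)

  μn<n : ∀ {μ n} → μ < 1# → 0# < n → μ * n < n
  μn<n {μ} {n} μ<1 0<n = <-respˡ-≈ (+-identityʳ _) (<-respʳ-≈ eq
    (+-monoʳ-< (μ * n) (*-pos (0<y-x μ<1) 0<n)))
    where
    eq : μ * n + (1# - μ) * n ≈ n
    eq = trans (sym (distribʳ n μ (1# - μ))) (trans (*-cong
      (trans (+-comm _ _) (trans (+-assoc _ _ _) (trans (+-cong ≈-refl (-‿inverseˡ μ)) (+-identityʳ 1#))))
      ≈-refl) (*-identityˡ n))

  -- A nonzero combination of eigenvectors for eigenvalues below 1 killed by
  -- all the functionals would have Rayleigh quotient both below 1 and at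
  -- least 1.
  module _ {n ℓ} {M : Matrix n} {I : Carrier → Set ℓ} (I<1 : ∀ {μ} → I μ → μ < 1#)
           (M-sym : Symmetric M) (functionals : List (List (Fin n)))
           (rayleigh : ∀ x → All (λ φ → ∑ x φ ≈ 0#) functionals → dot x x ≤ dot x (M *ᵥ x)) where

    count≤functionals : ∀ {m} → EigenvalueCount M I m → m ℕ.≤ length functionals
    count≤functionals record { r = r ; eigenvalue = μ ; inInterval = μ∈I ; distinct = distinct
                             ; multiplicity = d ; hasMult = mult ; total = refl } =
      ℕ.≮⇒≥ λ lt → kernel lt (λ i → flatten d (λ k j → ∑ (basis k j) (lookup functionals i)))
        λ (a , (p , ap#0) , aN) → absurd a p ap#0 aN
      where
      basis = λ k → HasMultiplicity.basis (mult k)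

      absurd : ∀ a p → a p # 0# →
        ¬ (∀ i → sum (λ p → a p * flatten d (λ k j → ∑ (basis k j) (lookup functionals i)) p) ≈ 0#)
      absurd a p ap#0 aN with embed-surjective d p
      ... | k , j , refl = proj₂ (tight _ _)
        (HasMultiplicity.independent (mult k) (a ∘ embed d k) (dot≤0⇒≈0 (n≤0 k)) j) ap#0
        where
        y : Fin r → Vector Carrier n
        y k = combination (a ∘ embed d k) (basis k)

        x : Vector Carrier n
        x = superpose y

        y-eig : ∀ k → y k ∈Eigenspace[ M , μ k ]
        y-eig k = combination∈Eigenspace (a ∘ embed d k) (basis k) (HasMultiplicity.eigenbasis (mult k))

        term : List (Fin n) → ∀ k → Fin (d k) → Carrier
        term φ k j = a (embed d k j) * ∑ (basis k j) φ

        linear : ∀ φ → ∑ x φ ≈ sum (λ k → sum (term φ k))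
        linear []      = sym (sum-zero λ k → sum-zero λ j → zeroʳ (a (embed d k j)))
        linear (v ∷ φ) = trans (+-cong ≈-refl (linear φ)) (trans
          (sym (∑-distrib-+ (λ k → y k v) (λ k → sum (term φ k))))
          (sum-cong λ k → trans
            (sym (∑-distrib-+ (λ j → a (embed d k j) * basis k j v) (term φ k)))
            (sum-cong λ j → sym (distribˡ (a (embed d k j)) (basis k j v) (∑ (basis k j) φ)))))

        vanish : All (λ φ → ∑ x φ ≈ 0#) functionals
        vanish = ≡.subst (All _) (tabulate-lookup functionals) (All.tabulate⁺ λ i →
          trans (linear (lookup functionals i)) (trans
            (sym (sum-flatten d a λ k j → ∑ (basis k j) (lookup functionals i))) (aN i)))

        orth : ∀ k l → k ≢ l → dot (y k) (y l) ≈ 0#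
        orth k l k≢l = orthogonal M-sym (distinct k l k≢l) (y-eig k) (y-eig l)

        -- By orthogonality the Rayleigh hypothesis reads Σ |y_k|² ≤ Σ μ_k |y_k|². As μ_k < 1, each
        -- term on the right is at most the corresponding one on the left, so no term can be
        -- strictly smaller. This forces every y_k to vanish, and independence of the eigenbases
        -- then kills the coefficient known to be apart from 0.
        squeeze : ∀ k → dot (y k) (y k) ≤ μ k * dot (y k) (y k)
        squeeze = sum-squeeze
          (λ k nk<μnk → ≈⊎<⊎> 0# (dot (y k) (y k)) λ
            { (inj₁ 0≈n) → <-irrefl (sym (trans (*-cong ≈-refl (sym 0≈n)) (trans (zeroʳ _) 0≈n))) nk<μnk
            ; (inj₂ (inj₁ 0<n)) → <⇒≤ (μn<n (I<1 (μ∈I k)) 0<n) nk<μnk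
            ; (inj₂ (inj₂ n<0)) → sum-nonneg (λ i → 0≤x*x (y k i)) n<0
            })
          (≤-resp₂ (dot-orthogonal y y orth)
            (trans (sum-cong λ i → *-cong (≈-refl {x i}) (*ᵥ-superpose {M = M} y i))
              (trans (dot-orthogonal y (λ k → M *ᵥ y k) λ k l k≢l →
                  trans (dot-scaleʳ M-sym (y-eig l) (y k)) (trans (*-cong ≈-refl (orth k l k≢l)) (zeroʳ _)))
                (sum-cong λ k → dot-scaleʳ M-sym (y-eig k) (y k))))
            (rayleigh x vanish))

        n≤0 : ∀ k → dot (y k) (y k) ≤ 0#
        n≤0 k 0<n = squeeze k (μn<n (I<1 (μ∈I k)) 0<n)

-- From a certificate to a bound on the eigenvalue count.

module CertificateBound {c ℓ₁ ℓ₂} (ℝ : RealNumbers c ℓ₁ ℓ₂) {n} (G : Graph (Fin n)) where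
  open Order ℝ
  open Sums ℝ using (∑; sq)
  open FinSums ℝ
  open Spectrum ℝ
  open Eigenvectors ℝ
  open Certificates G
  open QuadraticForm ℝ G

  private
    A : Matrix n
    A = adjacencyMatrix G

    A-sym : ∀ i j → A i j ≈ A j i
    A-sym i j rewrite adj-sym G i j = ≈-refl

  signlessLaplacian-sym : Symmetric (signlessLaplacian G)
  signlessLaplacian-sym i j = +-cong (lemma i j) (A-sym i j)
    where
    lemma : ∀ i j → degreeMatrix G i j ≈ degreeMatrix G j i
    lemma i j with i Fin.≟ j | j Fin.≟ i
    ... | yes refl | yes _    = ≈-refl
    ... | no  _    | no  _    = ≈-refl
    ... | yes refl | no  i≢i  = contradiction refl i≢i
    ... | no  i≢i  | yes refl = contradiction refl i≢i

  card≈sum : ∀ {m} (b : Fin m → Bool) →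
             ∣ tabulate b ∣ · 1# ≈ sum (λ j → if b j then 1# else 0#)
  card≈sum {zero}  b = ≈-refl
  card≈sum {suc m} b with b zero
  ... | true  = +-cong ≈-refl (card≈sum (b ∘ suc))
  ... | false = trans (card≈sum (b ∘ suc)) (sym (+-identityˡ _))

  diagonal : ∀ (a : Carrier) (x : Vector Carrier n) i →
             sum (λ j → (if does (i Fin.≟ j) then a else 0#) * x j) ≈ a * x i
  diagonal a x i = trans (sum-single (λ j → (if does (i Fin.≟ j) then a else 0#) * x j) i off) on
    where
    off : ∀ j → i ≢ j → (if does (i Fin.≟ j) then a else 0#) * x j ≈ 0#
    off j i≢j with i Fin.≟ j
    ... | yes i≡j = contradiction i≡j i≢j
    ... | no  _   = zeroˡ (x j)

    on : (if does (i Fin.≟ i) then a else 0#) * x i ≈ a * x i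
    on with i Fin.≟ i
    ... | yes _   = ≈-refl
    ... | no  i≢i = contradiction refl i≢i

  module _ (x : Vector Carrier n) where

    private
      E = dot x (signlessLaplacian G *ᵥ x)

      half : Fin n → Fin n → Carrier
      half i j = A i j * (x i * x i + x i * x j)

    row : ∀ i → x i * (signlessLaplacian G *ᵥ x) i ≈ sum (half i)
    row i = trans (*-cong (≈-refl {x i}) Qxᵢ) (trans
      (solve 3 (λ x d s → x :* (d :* x :+ s) := d :* (x :* x) :+ x :* s) ≈-refl
        (x i) (sum (A i)) (sum (λ j → A i j * x j)))
      (trans (+-cong (*-distribʳ-sum (x i * x i) (A i)) (*-distribˡ-sum (x i) (λ j → A i j * x j)))
        (trans (sym (∑-distrib-+ (λ j → A i j * (x i * x i)) (λ j → x i * (A i j * x j))))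
          (sum-cong λ j → solve 3 (λ a x y → a :* (x :* x) :+ x :* (a :* y) := a :* (x :* x :+ x :* y))
            ≈-refl (A i j) (x i) (x j)))))
      where
      Qxᵢ : (signlessLaplacian G *ᵥ x) i ≈ sum (A i) * x i + sum (λ j → A i j * x j)
      Qxᵢ = trans (sum-cong λ j → distribʳ (x j) (degreeMatrix G i j) (A i j))
        (trans (∑-distrib-+ (λ j → degreeMatrix G i j * x j) (λ j → A i j * x j))
          (+-cong (trans (diagonal (degree G i · 1#) x i) (*-cong (card≈sum (adj G i)) ≈-refl)) ≈-refl))

    -- Row i contributes A_ij (x_i² + x_i x_j); adding the transposed double sum completes each term
    -- to A_ij (x_i + x_j)².
    E+E≈Q+Q : E + E ≈ Q x (allFin n) + Q x (allFin n)
    E+E≈Q+Q = trans (+-cong E≈ (trans E≈ (trans (∑-comm half)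
        (sum-cong λ i → sum-cong λ j → *-cong (A-sym j i) ≈-refl))))
      (trans (sym (∑-distrib-+ (λ i → sum (half i)) (λ i → sum (λ j → A i j * (x j * x j + x j * x i)))))
      (trans (sum-cong λ i → trans (sym (∑-distrib-+ (half i) (λ j → A i j * (x j * x j + x j * x i))))
          (sum-cong λ j → edge i j))
        (trans (sym ∑∑≈sum) (∑∑≈Q+Q x (allFin n)))))
      where
      E≈ : E ≈ sum (λ i → sum (half i))
      E≈ = sum-cong row

      edge : ∀ i j → half i j + A i j * (x j * x j + x j * x i) ≈ weight x i j
      edge i j with adj G i j
      ... | true  = trans (+-cong (*-identityˡ _) (*-identityˡ _))
        (solve 2 (λ x y → (x :* x :+ x :* y) :+ (y :* y :+ y :* x) := (x :+ y) :* (x :+ y)) ≈-refl (x i) (x j))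
      ... | false = trans (+-cong (zeroˡ _) (zeroˡ _)) (+-identityˡ 0#)

      ∑∑≈sum : ∑ (λ u → ∑ (weight x u) (allFin n)) (allFin n) ≈ sum (λ i → sum (weight x i))
      ∑∑≈sum = trans (reflexive (∑-tabulate (λ u → ∑ (weight x u) (allFin n)) id))
        (sum-cong λ i → reflexive (∑-tabulate (weight x i) id))

  certificate⇒count≤ : (C : Certificate) → ∀ {m} →
    SignlessLaplacianCount G [ 0# , 1# ⟩ m → m ℕ.≤ Certificate.size C
  certificate⇒count≤ C count = ≡.subst (_ ℕ.≤_) size≡
    (count≤functionals proj₂ signlessLaplacian-sym (sums ++ values) rayleigh count)
    where
    open Certificate C

    sums values : List (List (Fin n))
    sums   = map (λ (a , b) → a ∷ b ∷ []) pairs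
    values = map (_∷ []) zeros

    size≡ : length (sums ++ values) ≡ size
    size≡ = ≡.trans (length-++ sums) (≡.cong₂ ℕ._+_ (length-map _ pairs) (length-map _ zeros))

    rayleigh : ∀ x → All (λ φ → ∑ x φ ≈ 0#) (sums ++ values) → dot x x ≤ dot x (signlessLaplacian G *ᵥ x)
    rayleigh x vanish = halve-≤ (≤-resp₂ (+-cong norm norm) (sym (E+E≈Q+Q x))
      (normSq≤Q x isCore
        (All.map (trans (+-cong ≈-refl (sym (+-identityʳ _)))) (All.map⁻ (All.++⁻ˡ sums vanish)))
        (All.map (trans (sym (+-identityʳ _))) (All.map⁻ (All.++⁻ʳ sums vanish)))
        partition covered))
      where
      norm : normSq x (allFin n) ≈ dot x x
      norm = reflexive (∑-tabulate (λ v → sq (x v)) id)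

-- Duplicate-free lists as finite sets.

module _ {A : Set} where

  Unique-resp-↭ : ∀ {xs ys : List A} → xs ↭ ys → Unique xs → Unique ys
  Unique-resp-↭ p = ↭ₛ.Unique-resp-↭ (≡.setoid A) (↭⇒↭ₛ p)

  Unique-++⁻ˡ : ∀ xs {ys : List A} → Unique (xs ++ ys) → Unique xs
  Unique-++⁻ˡ []       _        = []
  Unique-++⁻ˡ (x ∷ xs) (p ∷ u) = All.++⁻ˡ xs p ∷ Unique-++⁻ˡ xs u

  Unique-++⁻ʳ : ∀ xs {ys : List A} → Unique (xs ++ ys) → Unique ys
  Unique-++⁻ʳ xs {ys} u = ≡.subst Unique (drop-++ xs) (Unique.drop⁺ (length xs) u)
    where
    drop-++ : ∀ xs → drop (length xs) (xs ++ ys) ≡ ys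
    drop-++ []       = refl
    drop-++ (x ∷ xs) = drop-++ xs

  pick : ∀ {x} {xs : List A} → x ∈ xs → ∃[ ys ] xs ↭ x ∷ ys
  pick x∈xs with ∈-∃++ x∈xs
  ... | ys , zs , refl = ys ++ zs , shift _ ys zs

  ∈-tail : ∀ {x y} {xs : List A} → x ∈ y ∷ xs → x ≢ y → x ∈ xs
  ∈-tail (here x≡y) x≢y = contradiction x≡y x≢y
  ∈-tail (there i)  _   = i

  complement : ∀ {xs ys : List A} → Unique xs → (∀ {x} → x ∈ xs → x ∈ ys) → ∃[ zs ] xs ++ zs ↭ ys
  complement {[]}     {ys} _ _ = ys , ↭-refl
  complement {x ∷ xs} (x∉xs ∷ xs!) xs⊆ys with pick (xs⊆ys (here refl))
  ... | ys′ , ys↭ with complement {ys = ys′} xs! (λ i →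
          ∈-tail (∈-resp-↭ ys↭ (xs⊆ys (there i))) (≡.≢-sym (All.lookup x∉xs i)))
  ... | zs , p = zs , ↭-trans (prep x p) (↭-sym ys↭)

module ↭-Solver {n} = CommutativeMonoidSolver (++-commutativeMonoid {A = Fin n})

-- Matchings with a chosen centre on each edge, and augmentation.

module MaximumMatching {n} (G : Graph (Fin n)) where
  open Certificates G
  open ↭-Solver {n}

  Edge = Fin n × Fin n

  IsEdge : Edge → Set
  IsEdge (u , v) = u ~ v

  ~-sym : ∀ {u v} → u ~ v → v ~ u
  ~-sym {u} {v} u~v = ≡.trans (adj-sym G v u) u~v

  ~-irrefl : ∀ {v} → ¬ v ~ v
  ~-irrefl {v} v~v with ≡.trans (≡.sym v~v) (adj-irrefl G v)
  ... | ()

  _~?_ : ∀ u v → Dec (u ~ v)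
  u ~? v = adj G u v Bool.≟ true

  -- Which endpoint of an edge is the centre is a free choice, made in orient.
  centres leaves : List Edge → List (Fin n)
  centres = map proj₁
  leaves  = map proj₂

  -- The one permutation says both that all endpoints are distinct and that `W` consists of exactly
  -- the unmatched vertices.
  record IsMatching (E : List Edge) (W : List (Fin n)) : Set where
    field
      areEdges  : All IsEdge E
      partition : leaves E ++ centres E ++ W ↭ allFin n

  open IsMatching

  cover : ∀ {E W} → IsMatching E W → ∀ v → v ∈ leaves E ⊎ v ∈ centres E ⊎ v ∈ W
  cover {E} M v = [ inj₁ , inj₂ ∘ ∈-++⁻ (centres E) ]′
    (∈-++⁻ (leaves E) (∈-resp-↭ (↭-sym (partition M)) (∈-allFin v)))

  unique : ∀ {E W} → IsMatching E W → Unique (leaves E ++ centres E ++ W)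
  unique M = Unique-resp-↭ (↭-sym (partition M)) (Unique.allFin⁺ n)

  reorder : ∀ {E E′ W} → E ↭ E′ → IsMatching E W → IsMatching E′ W
  reorder p M = record
    { areEdges  = All-resp-↭ p (areEdges M)
    ; partition = ↭-trans
        (++⁺ (map⁺ proj₂ (↭-sym p)) (++⁺ʳ _ (map⁺ proj₁ (↭-sym p)))) (partition M)
    }

  reorderW : ∀ {E W W′} → W ↭ W′ → IsMatching E W → IsMatching E W′
  reorderW {E} p M = record
    { areEdges  = areEdges M
    ; partition = ↭-trans (++⁺ˡ (leaves E) (++⁺ˡ (centres E) (↭-sym p))) (partition M)
    }

  flip : ∀ {c l R W} → IsMatching ((c , l) ∷ R) W → IsMatching ((l , c) ∷ R) W
  flip {c} {l} {R} {W} M = record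
    { areEdges  = ~-sym (All.head (areEdges M)) ∷ All.tail (areEdges M)
    ; partition = ↭-trans
        (solve 5 (λ c l L C W → (c ⊕ L) ⊕ ((l ⊕ C) ⊕ W) ⊜ (l ⊕ L) ⊕ ((c ⊕ C) ⊕ W)) ↭-refl
          [ c ] [ l ] (leaves R) (centres R) W)
        (partition M)
    }

  -- `P` lists the matched edges in the order of traversal, each written from the endpoint entered
  -- to the endpoint left. Uses of it therefore flip some edges beforehand, regardless of which
  -- endpoint is the centre.
  AlternatingPath : Fin n → List Edge → Fin n → Set
  AlternatingPath u []            v = u ~ v
  AlternatingPath u ((x , y) ∷ P) v = u ~ x × AlternatingPath y P v

  complementary : Fin n → List Edge → Fin n → List Edge
  complementary u []            v = (u , v) ∷ []
  complementary u ((x , y) ∷ P) v = (u , x) ∷ complementary y P v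

  length-complementary : ∀ u P v R → length (complementary u P v ++ R) ≡ suc (length (P ++ R))
  length-complementary u []            v R = refl
  length-complementary u ((x , y) ∷ P) v R = ≡.cong suc (length-complementary y P v R)

  private
    areEdges-complementary : ∀ {u} P {v R} → AlternatingPath u P v → All IsEdge (P ++ R) →
                             All IsEdge (complementary u P v ++ R)
    areEdges-complementary []            u~v       es       = u~v ∷ es
    areEdges-complementary ((x , y) ∷ P) (u~x , p) (_ ∷ es) = u~x ∷ areEdges-complementary P p es

    leaves-complementary : ∀ u P v R → leaves (complementary u P v ++ R) ≡ centres P ++ v ∷ leaves R
    leaves-complementary u []            v R = refl
    leaves-complementary u ((x , y) ∷ P) v R = ≡.cong (x ∷_) (leaves-complementary y P v R)

    centres-complementary : ∀ u P v R → centres (complementary u P v ++ R) ≡ u ∷ leaves P ++ centres R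
    centres-complementary u []            v R = refl
    centres-complementary u ((x , y) ∷ P) v R = ≡.cong (u ∷_) (centres-complementary y P v R)

  augment : ∀ {u} P {v R W} → AlternatingPath u P v → IsMatching (P ++ R) (u ∷ v ∷ W) →
            IsMatching (complementary u P v ++ R) W
  augment {u} P {v} {R} {W} p M = record
    { areEdges  = areEdges-complementary P p (areEdges M)
    ; partition = ↭-trans
        (≡.subst₂ (λ L C → L ++ C ++ W ↭ leaves (P ++ R) ++ centres (P ++ R) ++ u ∷ v ∷ W)
          (≡.sym (leaves-complementary u P v R)) (≡.sym (centres-complementary u P v R))
          (≡.subst₂ (λ L C → (centres P ++ v ∷ leaves R) ++ (u ∷ leaves P ++ centres R) ++ W
                              ↭ L ++ C ++ u ∷ v ∷ W)
            (≡.sym (map-++ proj₂ P R)) (≡.sym (map-++ proj₁ P R))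
            (solve 7 (λ u v Lp Cp Lr Cr W →
              (Cp ⊕ (v ⊕ Lr)) ⊕ ((u ⊕ (Lp ⊕ Cr)) ⊕ W) ⊜ (Lp ⊕ Lr) ⊕ ((Cp ⊕ Cr) ⊕ (u ⊕ (v ⊕ W))))
              ↭-refl [ u ] [ v ] (leaves P) (centres P) (leaves R) (centres R) W)))
        (partition M)
    }

  -- What can be achieved before triangles are excluded: an unmatched vertex may see the leaf only
  -- as the tip of a triangle over the matched edge. It already suffices for the centres to dominate
  -- the unmatched vertices.
  Weak : List (Fin n) → Edge → Set
  Weak W (c , l) = All (λ u → u ~ l → u ~ c) W

  leaves-dominated : ∀ {R} → All IsEdge R → All (λ v → Any (v ~_) (centres R)) (leaves R)
  leaves-dominated []                 = []
  leaves-dominated (_∷_ {_ , _} e es) = here (~-sym e) ∷ All.map there (leaves-dominated es)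

  ∈-leaves : ∀ {l R} → l ∈ leaves R → ∃[ c ] ∃[ R′ ] R ↭ (c , l) ∷ R′
  ∈-leaves l∈ with ∈-map⁻ proj₂ l∈
  ... | (c , l) , e∈R , refl with pick e∈R
  ... | R′ , p = c , R′ , p

  ∈-centres : ∀ {c R} → c ∈ centres R → ∃[ l ] ∃[ R′ ] R ↭ (c , l) ∷ R′
  ∈-centres c∈ with ∈-map⁻ proj₁ c∈
  ... | (c , l) , e∈R , refl with pick e∈R
  ... | R′ , p = l , R′ , p

-- Pentagons as connected components.

succ₅ pred₅ : Fin 5 → Fin 5
succ₅ 0F = 1F
succ₅ 1F = 2F
succ₅ 2F = 3F
succ₅ 3F = 4F
succ₅ 4F = 0F
pred₅ 0F = 4F
pred₅ 1F = 0F
pred₅ 2F = 1F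
pred₅ 3F = 2F
pred₅ 4F = 3F

C₅-neighbours : ∀ a b → adj C₅ a b ≡ true → b ≡ succ₅ a ⊎ b ≡ pred₅ a
C₅-neighbours = from-yes (Fin.all? λ a → Fin.all? λ b →
  (adj C₅ a b Bool.≟ true) →-dec ((b Fin.≟ succ₅ a) ⊎-dec (b Fin.≟ pred₅ a)))

C₅-succ : ∀ a → adj C₅ a (succ₅ a) ≡ true
C₅-succ = from-yes (Fin.all? λ a → adj C₅ a (succ₅ a) Bool.≟ true)

C₅-pred : ∀ a → adj C₅ a (pred₅ a) ≡ true
C₅-pred = from-yes (Fin.all? λ a → adj C₅ a (pred₅ a) Bool.≟ true)

record PentagonComponent {n} (G : Graph (Fin n)) : Set where
  open Certificates G
  field
    at        : Fin 5 → Fin n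
    injective : ∀ {a b} → at a ≡ at b → a ≡ b
    succ-edge : ∀ a → at a ~ at (succ₅ a)
    closed    : ∀ a {v} → at a ~ v → v ≡ at (succ₅ a) ⊎ v ≡ at (pred₅ a)

lookup-injective : ∀ {A : Set} {xs : List A} → Unique xs → ∀ i j → lookup xs i ≡ lookup xs j → i ≡ j
lookup-injective (_  ∷ _) zero    zero    _  = refl
lookup-injective (p  ∷ _) zero    (suc j) eq = contradiction eq (All.lookup p (∈-lookup j))
lookup-injective (p  ∷ _) (suc i) zero    eq = contradiction (≡.sym eq) (All.lookup p (∈-lookup i))
lookup-injective (_  ∷ u) (suc i) (suc j) eq = ≡.cong suc (lookup-injective u i j eq)

-- The structure of a graph without a certificate below ν.

module Uncertified {n} (G : Graph (Fin n)) (ν : ℕ)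
  (maximal : ∀ {E W} → MaximumMatching.IsMatching G E W → length E ℕ.≤ ν)
  (ν≤size : ∀ C → ν ℕ.≤ Certificates.Certificate.size {G = G} C)
  (another-neighbour : ∀ v u → ∃[ w ] Certificates._~_ G v w × w ≢ u) where
  open Certificates G
  open MaximumMatching G
  open IsMatching
  open ↭-Solver {n} using (solve; _⊕_; _⊜_)

  record Maximum (E : List Edge) (W : List (Fin n)) : Set where
    field
      isMatching : IsMatching E W
      attained   : length E ≡ ν

  open Maximum

  edge : ∀ {e R W} → Maximum (e ∷ R) W → IsEdge e
  edge = All.head ∘ areEdges ∘ isMatching

  reorderᴹ : ∀ {E E′ W} → E ↭ E′ → Maximum E W → Maximum E′ W
  reorderᴹ p M = record
    { isMatching = reorder p (isMatching M)
    ; attained   = ≡.trans (↭-length (↭-sym p)) (attained M)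
    }

  flipᴹ : ∀ {c l R W} → Maximum ((c , l) ∷ R) W → Maximum ((l , c) ∷ R) W
  flipᴹ M = record { isMatching = flip (isMatching M) ; attained = attained M }

  flip-at : ∀ P {c l R W} → Maximum (P ++ (c , l) ∷ R) W → Maximum (P ++ (l , c) ∷ R) W
  flip-at P {R = R} = reorderᴹ (↭-sym (shift _ P R)) ∘ flipᴹ ∘ reorderᴹ (shift _ P R)

  no-augmenting : ∀ {u} P {v R W} → Maximum (P ++ R) W → u ∈ W → v ∈ W → u ≢ v →
                  ¬ AlternatingPath u P v
  no-augmenting {u} P {v} {R} M u∈W v∈W u≢v p with pick u∈W
  ... | W₁ , W↭ with pick (∈-tail (∈-resp-↭ W↭ v∈W) (≡.≢-sym u≢v))
  ... | W₂ , W₁↭ = ℕ.1+n≰n (≡.subst₂ ℕ._≤_ (length-complementary u P v R) (≡.sym (attained M))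
    (maximal (augment P p (reorderW (↭-trans W↭ (prep u W₁↭)) (isMatching M)))))

  ~⇒≢ : ∀ {u v} → u ~ v → u ≢ v
  ~⇒≢ u~v refl = ~-irrefl u~v

  independent : ∀ {E W u v} → Maximum E W → u ∈ W → v ∈ W → ¬ u ~ v
  independent M u∈W v∈W u~v = no-augmenting [] M u∈W v∈W (~⇒≢ u~v) u~v

  Covered : List (Fin n) → List (Fin n × Fin n) → Fin n → Set
  Covered zeros pairs v = Any (v ~_) zeros ⊎ Any (Joins v) pairs

  -- The common end of the exclusions by domination: one form fewer than there are matched edges
  -- already contradicts `ν≤size`.
  uncertifiable : ∀ {E W rest core zeros pairs} → Maximum E W → Core core pairs →
    rest ++ core ++ zeros ↭ leaves E ++ centres E ++ W →
    All (Covered zeros pairs) rest →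
    suc (length pairs ℕ.+ length zeros) ≢ length E
  uncertifiable M isCore p covered eq = ℕ.1+n≰n
    (≡.subst (ℕ._≤ _) (≡.trans (≡.sym (attained M)) (≡.sym eq)) (ν≤size (record
      { isCore    = isCore
      ; partition = ↭-trans p (partition (isMatching M))
      ; covered   = covered
      })))

  leaves-covered : ∀ {R zeros pairs} → All IsEdge R → (∀ {z} → z ∈ centres R → z ∈ zeros) →
                   All (Covered zeros pairs) (leaves R)
  leaves-covered es ⊆ = All.map
    (λ i → let z , z∈ , v~z = find i in inj₁ (lose (⊆ z∈) v~z)) (leaves-dominated es)

  -- If some unmatched u sees l but not c, then an unmatched v seeing c differs from u and u l c v
  -- is augmenting. So no unmatched vertex sees c, and the flipped edge is weak vacuously.
  orient-edge : ∀ {c l R W} → Maximum ((c , l) ∷ R) W → Weak W (c , l) ⊎ Weak W (l , c)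
  orient-edge {c} {l} {R} {W} M with any? (λ u → (u ~? l) ×-dec ¬? (u ~? c)) W
  ... | no ¬∃  = inj₁ (All.tabulate λ {u} u∈W u~l → case-~ u∈W u~l)
    where
    case-~ : ∀ {u} → u ∈ W → u ~ l → u ~ c
    case-~ {u} u∈W u~l with u ~? c
    ... | yes u~c = u~c
    ... | no  u≁c = contradiction (lose u∈W (u~l , u≁c)) ¬∃
  ... | yes ∃u with find ∃u
  ... | u , u∈W , u~l , u≁c = inj₂ (All.tabulate λ v∈W v~c →
    ⊥-elim (no-augmenting [ (l , c) ] (flipᴹ M) u∈W v∈W (λ { refl → u≁c v~c }) (u~l , ~-sym v~c)))

  SameVertices : List Edge → List Edge → Set
  SameVertices E′ E = leaves E′ ++ centres E′ ↭ leaves E ++ centres E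

  ∷-vertices : ∀ {c l E E′} → SameVertices E′ E → SameVertices ((c , l) ∷ E′) ((c , l) ∷ E)
  ∷-vertices {c} {l} {E} {E′} p = prep l (↭-trans (shift c (leaves E′) (centres E′))
    (↭-trans (prep c p) (↭-sym (shift c (leaves E) (centres E)))))

  flip-vertices : ∀ {c l} E → SameVertices ((l , c) ∷ E) ((c , l) ∷ E)
  flip-vertices {c} {l} E = ↭-trans (prep c (shift l (leaves E) (centres E)))
    (↭-trans (swap c l ↭-refl) (prep l (↭-sym (shift c (leaves E) (centres E)))))

  replace : ∀ {E E′ W} → Maximum E W → All IsEdge E′ → SameVertices E′ E → length E′ ≡ length E →
            Maximum E′ W
  replace {E} {E′} {W} M es p eq = record
    { isMatching = record
      { areEdges  = es
      ; partition = ↭-trans (↭-trans (assoc E′) (↭-trans (++⁺ʳ W p) (↭-sym (assoc E))))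
          (partition (isMatching M))
      }
    ; attained = ≡.trans eq (attained M)
    }
    where
    assoc : ∀ E → leaves E ++ centres E ++ W ↭ (leaves E ++ centres E) ++ W
    assoc E = ↭-sym (++-assoc (leaves E) (centres E) W)

  Orientable : List (Fin n) → Edge → Set
  Orientable W (c , l) = c ~ l × (Weak W (c , l) ⊎ Weak W (l , c))

  orientable : ∀ {E W} → Maximum E W → ∀ {e} → e ∈ E → Orientable W e
  orientable M {c , l} e∈E with pick e∈E
  ... | R , p = edge M′ , orient-edge M′
    where M′ = reorderᴹ p M

  orient : ∀ {W} E → All (Orientable W) E → ∃[ E′ ]
    All IsEdge E′ × All (Weak W) E′ × SameVertices E′ E × length E′ ≡ length E
  orient []            []       = [] , [] , [] , ↭-refl , refl
  orient ((c , l) ∷ E) ((c~l , o) ∷ os) with orient E os | o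
  ... | E′ , es , ws , p , eq | inj₁ w =
    (c , l) ∷ E′ , c~l ∷ es , w ∷ ws , ∷-vertices p , ≡.cong suc eq
  ... | E′ , es , ws , p , eq | inj₂ w =
    (l , c) ∷ E′ , ~-sym c~l ∷ es , w ∷ ws , ↭-trans (∷-vertices p) (flip-vertices E) , ≡.cong suc eq

  module _ {E W} (M : Maximum E W) where

    W-unique : Unique W
    W-unique = Unique-++⁻ʳ (centres E) (Unique-++⁻ʳ (leaves E) (unique (isMatching M)))

    picked-≢ : ∀ {w W′ u} → W ↭ w ∷ W′ → u ∈ W′ → u ≢ w
    picked-≢ W↭ u∈W′ refl = Unique.Unique[x∷xs]⇒x∉xs (Unique-resp-↭ W↭ W-unique) u∈W′

  -- The triangle a b w is a core without forms, so the centres of the other edges would have to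
  -- fail to dominate. They do not: another unmatched vertex seeing a or b gives an augmenting path
  -- ending in w.
  triangle-free : ∀ {a b R w W} → Maximum ((a , b) ∷ R) W → w ∈ W → w ~ a → ¬ w ~ b
  triangle-free {a} {b} {R} {w} {W} M w∈W w~a w~b
    with pick w∈W | orient R (All.tabulate (orientable M ∘ there))
  ... | W′ , W↭ | R′ , es , ws , p , eq = uncertifiable {rest = leaves R′ ++ W′} M′
    (triangle (edge M) (~-sym w~a) (~-sym w~b))
    (↭-trans
      (solve 6 (λ a b w L C W → (L ⊕ W) ⊕ ((a ⊕ (b ⊕ w)) ⊕ C) ⊜ (b ⊕ L) ⊕ ((a ⊕ C) ⊕ (w ⊕ W)))
        ↭-refl [ a ] [ b ] [ w ] (leaves R′) (centres R′) W′)
      (++⁺ˡ (leaves E′) (++⁺ˡ (centres E′) (↭-sym W↭))))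
    (All.++⁺ (leaves-covered es id) (All.tabulate dominated))
    (≡.cong suc (length-map proj₁ R′))
    where
    E′ = (a , b) ∷ R′
    M′ : Maximum E′ W
    M′ = replace M (edge M ∷ es) (∷-vertices p) (≡.cong suc eq)

    dominated : ∀ {u} → u ∈ W′ → Covered (centres R′) [] u
    dominated {u} u∈W′ with another-neighbour u u
    ... | v , u~v , _ = by-cases (cover (isMatching M′) v)
      where
      u≢w = picked-≢ M W↭ u∈W′
      u∈W = ∈-resp-↭ (↭-sym W↭) (there u∈W′)

      by-cases : v ∈ leaves E′ ⊎ v ∈ centres E′ ⊎ v ∈ W → Covered (centres R′) [] u
      by-cases (inj₁ (here refl)) =
        contradiction (u~v , ~-sym w~a) (no-augmenting [ (b , a) ] (flipᴹ M) u∈W w∈W u≢w)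
      by-cases (inj₁ (there v∈)) with ∈-map⁻ proj₂ v∈
      ... | (c , l) , e∈ , refl = inj₁ (lose (∈-map⁺ proj₁ e∈) (All.lookup (All.lookup ws e∈) u∈W u~v))
      by-cases (inj₂ (inj₁ (here refl))) =
        contradiction (u~v , ~-sym w~b) (no-augmenting [ (a , b) ] M u∈W w∈W u≢w)
      by-cases (inj₂ (inj₁ (there v∈))) = inj₁ (lose v∈ u~v)
      by-cases (inj₂ (inj₂ v∈W)) = contradiction u~v (independent M u∈W v∈W)

  -- Orientations in which no leaf has an unmatched neighbour.

  Free : List (Fin n) → Fin n → Set
  Free W v = All (λ u → ¬ u ~ v) W

  record Oriented (E : List Edge) (W : List (Fin n)) : Set where
    field
      isMaximum  : Maximum E W
      leavesFree : All (Free W ∘ proj₂) E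

  open Oriented

  oriented : ∀ {E W} → Maximum E W → ∃[ E′ ] Oriented E′ W
  oriented {E} {W} M with orient E (All.tabulate (orientable M))
  ... | E′ , es , ws , p , eq = E′ , record
    { isMaximum  = M′
    ; leavesFree = All.tabulate λ e∈ → All.tabulate λ u∈W u~l →
        let u~c = All.lookup (All.lookup ws e∈) u∈W u~l
            _ , q = pick e∈
        in triangle-free (reorderᴹ q M′) u∈W u~c u~l
    }
    where M′ = replace M es p eq

  reorderᴼ : ∀ {E E′ W} → E ↭ E′ → Oriented E W → Oriented E′ W
  reorderᴼ p O = record
    { isMaximum = reorderᴹ p (isMaximum O) ; leavesFree = All-resp-↭ p (leavesFree O) }

  flipᴼ : ∀ {c l R W} → Free W c → Oriented ((c , l) ∷ R) W → Oriented ((l , c) ∷ R) W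
  flipᴼ f O = record { isMaximum = flipᴹ (isMaximum O) ; leavesFree = f ∷ All.tail (leavesFree O) }

  matching : ∀ {E W} → Oriented E W → IsMatching E W
  matching = isMatching ∘ isMaximum

  leaf-free : ∀ {E W l u} → Oriented E W → l ∈ leaves E → u ∈ W → ¬ u ~ l
  leaf-free O l∈ u∈W u~l with ∈-map⁻ proj₂ l∈
  ... | e , e∈ , refl = All.lookup (All.lookup (leavesFree O) e∈) u∈W u~l

  centre-neighbour : ∀ {E W u} → Oriented E W → u ∈ W → ∀ d → ∃[ c ] c ∈ centres E × u ~ c × c ≢ d
  centre-neighbour {u = u} O u∈W d with another-neighbour u d
  ... | c , u~c , c≢d with cover (matching O) c
  ... | inj₁ c∈        = contradiction u~c (leaf-free O c∈ u∈W)
  ... | inj₂ (inj₁ c∈) = c , c∈ , u~c , c≢d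
  ... | inj₂ (inj₂ c∈) = contradiction u~c (independent (isMaximum O) u∈W c∈)

  leaf-neighbour : ∀ {E W l} → Oriented E W → l ∈ leaves E → ∀ d →
                   ∃[ v ] (v ∈ leaves E ⊎ v ∈ centres E) × l ~ v × v ≢ d
  leaf-neighbour {l = l} O l∈ d with another-neighbour l d
  ... | v , l~v , v≢d with cover (matching O) v
  ... | inj₁ v∈        = v , inj₁ v∈ , l~v , v≢d
  ... | inj₂ (inj₁ v∈) = v , inj₂ v∈ , l~v , v≢d
  ... | inj₂ (inj₂ v∈) = contradiction (~-sym l~v) (leaf-free O l∈ v∈)

  edges : ∀ {E W} → Oriented E W → All IsEdge E
  edges = areEdges ∘ matching

  -- Replaces the forms for cⱼ and cᵣ by the single form x_{cⱼ} + x_{cᵣ}; no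
  -- vertex may then depend on just one of the two centres.
  no-cherry : ∀ {cⱼ lⱼ cᵣ lᵣ R W d} → Oriented ((cⱼ , lⱼ) ∷ (cᵣ , lᵣ) ∷ R) W → lⱼ ~ cᵣ →
              lᵣ ~ d → d ∈ cⱼ ∷ cᵣ ∷ centres R → ¬ d ≢ cᵣ
  no-cherry {cⱼ} {lⱼ} {cᵣ} {lᵣ} {R} {W} {d} O lⱼ~cᵣ lᵣ~d d∈ d≢cᵣ with edges O
  ... | cⱼ~lⱼ ∷ cᵣ~lᵣ ∷ es = uncertifiable {rest = lᵣ ∷ leaves R ++ W} (isMaximum O)
    (cherry (~-sym cⱼ~lⱼ) lⱼ~cᵣ)
    (solve 7 (λ cj lj cr lr L C W →
      (lr ⊕ (L ⊕ W)) ⊕ ((lj ⊕ (cj ⊕ cr)) ⊕ C) ⊜ (lj ⊕ (lr ⊕ L)) ⊕ ((cj ⊕ (cr ⊕ C)) ⊕ W)) ↭-refl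
      [ cⱼ ] [ lⱼ ] [ cᵣ ] [ lᵣ ] (leaves R) (centres R) W)
    (lᵣ-covered d∈ ∷ All.++⁺ (leaves-covered es id) (All.tabulate u-covered))
    (≡.cong (2 ℕ.+_) (length-map proj₁ R))
    where
    lᵣ-covered : d ∈ cⱼ ∷ cᵣ ∷ centres R → Covered (centres R) _ lᵣ
    lᵣ-covered (here refl)         = inj₂ (here (lᵣ~d , ~-sym cᵣ~lᵣ))
    lᵣ-covered (there (here d≡cᵣ)) = contradiction d≡cᵣ d≢cᵣ
    lᵣ-covered (there (there d∈))  = inj₁ (lose d∈ lᵣ~d)

    u-covered : ∀ {u} → u ∈ W → Covered (centres R) _ u
    u-covered u∈W with centre-neighbour O u∈W cⱼ
    ... | _ , here refl , _ , c≢cⱼ = contradiction refl c≢cⱼ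
    ... | _ , there (there c∈) , u~c , _ = inj₁ (lose c∈ u~c)
    ... | _ , there (here refl) , u~cᵣ , _ with centre-neighbour O u∈W cᵣ
    ...   | _ , here refl , u~cⱼ , _ = inj₂ (here (u~cⱼ , u~cᵣ))
    ...   | _ , there (here refl) , _ , c≢cᵣ = contradiction refl c≢cᵣ
    ...   | _ , there (there c∈) , u~c , _ = inj₁ (lose c∈ u~c)

  -- Two forms replace three centres. The six endpoints lie in the core and the other leaves see
  -- their own centres, so the last hypothesis is exactly what remains: domination of the unmatched
  -- vertices.
  no-house : ∀ {cᵢ lᵢ cₖ lₖ cⱼ lⱼ R W} → Oriented ((cᵢ , lᵢ) ∷ (cₖ , lₖ) ∷ (cⱼ , lⱼ) ∷ R) W →
    lᵢ ~ lₖ → lⱼ ~ cᵢ →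
    ¬ (∀ {u} → u ∈ W → Any (u ~_) (centres R) ⊎ (u ~ cⱼ × (u ~ cᵢ ⊎ u ~ cₖ)))
  no-house {cᵢ} {lᵢ} {cₖ} {lₖ} {cⱼ} {lⱼ} {R} {W} O lᵢ~lₖ lⱼ~cᵢ f with edges O
  ... | cᵢ~lᵢ ∷ cₖ~lₖ ∷ cⱼ~lⱼ ∷ es = uncertifiable {rest = leaves R ++ W} (isMaximum O)
    (house lᵢ~lₖ (~-sym cᵢ~lᵢ) (~-sym cₖ~lₖ) lⱼ~cᵢ (~-sym cⱼ~lⱼ))
    (solve 9 (λ ci li ck lk cj lj L C W →
      (L ⊕ W) ⊕ ((li ⊕ (lk ⊕ (lj ⊕ (ci ⊕ (ck ⊕ cj))))) ⊕ C) ⊜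
      (li ⊕ (lk ⊕ (lj ⊕ L))) ⊕ ((ci ⊕ (ck ⊕ (cj ⊕ C))) ⊕ W)) ↭-refl
      [ cᵢ ] [ lᵢ ] [ cₖ ] [ lₖ ] [ cⱼ ] [ lⱼ ] (leaves R) (centres R) W)
    (All.++⁺ (leaves-covered es id) (All.tabulate λ u∈W → u-covered (f u∈W)))
    (≡.cong (3 ℕ.+_) (length-map proj₁ R))
    where
    u-covered : ∀ {u} → Any (u ~_) (centres R) ⊎ (u ~ cⱼ × (u ~ cᵢ ⊎ u ~ cₖ)) → Covered (centres R) _ u
    u-covered (inj₁ i)                    = inj₁ i
    u-covered (inj₂ (u~cⱼ , inj₁ u~cᵢ)) = inj₂ (here (u~cᵢ , u~cⱼ))
    u-covered (inj₂ (u~cⱼ , inj₂ u~cₖ)) = inj₂ (there (here (u~cₖ , u~cⱼ)))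

  -- Every centre has an unmatched neighbour.

  bring : ∀ {e R R′} {f : Edge} → R ↭ f ∷ R′ → e ∷ R ↭ f ∷ e ∷ R′
  bring p = ↭-trans (prep _ p) (swap _ _ ↭-refl)

  -- Neither p nor q has an unmatched neighbour, so the edge can be oriented either way. If q sees a
  -- further centre, `centres R` alone dominates. If q sees a leaf q′, then q is made the centre: q′
  -- joins it to the centre of q′ in a cherry, and p′ looks after the new leaf p.
  no-free₁ : ∀ {p q R W p′} → Oriented ((p , q) ∷ R) W → Free W p →
             p ~ p′ → p′ ≢ q → p′ ∉ centres R
  no-free₁ {p} {q} {R} {W} {p′} O free p~p′ p′≢q p′∈ with leaf-neighbour O (here refl) p
  ... | _  , inj₁ (here refl)  , q~q  , _    = ~-irrefl q~q
  ... | _  , inj₂ (here refl)  , _    , q′≢p = q′≢p refl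
  ... | q′ , inj₁ (there q′∈)  , q~q′ , _ with ∈-leaves q′∈
  ...   | cₘ , R′ , R↭ = no-cherry (reorderᴼ (bring R↭) (flipᴼ free O)) (~-sym q~q′) p~p′
    (insert (∈-resp-↭ (map⁺ proj₁ R↭) p′∈)) p′≢q
    where
    insert : ∀ {x y z} {xs : List (Fin n)} → x ∈ y ∷ xs → x ∈ y ∷ z ∷ xs
    insert (here eq) = here eq
    insert (there i) = there (there i)
  no-free₁ {p} {q} {R} {W} {p′} O free p~p′ p′≢q p′∈ | q′ , inj₂ (there q′∈) , q~q′ , _ =
    uncertifiable {rest = p ∷ q ∷ leaves R ++ W} (isMaximum O) none
      (solve 5 (λ p q L C W → (p ⊕ (q ⊕ (L ⊕ W))) ⊕ C ⊜ (q ⊕ L) ⊕ ((p ⊕ C) ⊕ W)) ↭-refl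
        [ p ] [ q ] (leaves R) (centres R) W)
      (inj₁ (lose p′∈ p~p′) ∷ inj₁ (lose q′∈ q~q′) ∷
        All.++⁺ (leaves-covered (All.tail (edges O)) id) (All.tabulate u-covered))
      (≡.cong suc (length-map proj₁ R))
    where
    u-covered : ∀ {u} → u ∈ W → Covered (centres R) [] u
    u-covered u∈W with centre-neighbour O u∈W p
    ... | _ , here refl , _   , p≢p = contradiction refl p≢p
    ... | _ , there c∈  , u~c , _   = inj₁ (lose c∈ u~c)

  free? : ∀ W v → Free W v ⊎ ∃[ u ] u ∈ W × u ~ v
  free? W v with any? (_~? v) W
  ... | yes ∃u = inj₂ (find ∃u)
  ... | no ¬∃u = inj₁ (All.tabulate λ u∈W u~v → ¬∃u (lose u∈W u~v))

  -- Here w cₖ lₖ p q lⱼ cⱼ would be a 7-cycle, unless there is an augmenting path.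
  no-free₃ : ∀ {p q cₖ lₖ cⱼ lⱼ R W} → Oriented ((p , q) ∷ (cₖ , lₖ) ∷ (cⱼ , lⱼ) ∷ R) W → Free W p →
             p ~ lₖ → q ~ lⱼ →
             (∃[ u ] u ∈ W × u ~ cₖ) → ¬ (∃[ u ] u ∈ W × u ~ cⱼ)
  no-free₃ {p} {q} {cₖ} {lₖ} {cⱼ} {lⱼ} {R} {W} O free p~lₖ q~lⱼ (w , w∈W , w~cₖ) (w′ , w′∈W , w′~cⱼ) =
    -- The path of the house is p q lⱼ cⱼ, and its third centre is cₖ, which shares the neighbour lₖ
    -- with p. By `same`, only one unmatched vertex sees cₖ or cⱼ, and it sees both.
    no-house (reorderᴼ (prep _ (swap _ _ ↭-refl)) O) q~lⱼ (~-sym p~lₖ) u-covered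
    where
    same : ∀ {u u′} → u ∈ W → u′ ∈ W → u ~ cₖ → u′ ~ cⱼ → u ≡ u′
    same {u} {u′} u∈W u′∈W u~cₖ u′~cⱼ with u Fin.≟ u′
    ... | yes u≡u′ = u≡u′
    ... | no  u≢u′ = ⊥-elim (no-augmenting ((cₖ , lₖ) ∷ (p , q) ∷ (lⱼ , cⱼ) ∷ [])
      (reorderᴹ (swap _ _ ↭-refl) (flip-at (_ ∷ _ ∷ []) (isMaximum O))) u∈W u′∈W u≢u′
      (u~cₖ , ~-sym p~lₖ , q~lⱼ , ~-sym u′~cⱼ))

    u-covered : ∀ {u} → u ∈ W → Any (u ~_) (centres R) ⊎ (u ~ cₖ × (u ~ p ⊎ u ~ cⱼ))
    u-covered {u} u∈W with u ~? cₖ | u ~? cⱼ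
    ... | yes u~cₖ | _ with same u∈W w′∈W u~cₖ w′~cⱼ
    ...   | refl = inj₂ (u~cₖ , inj₂ w′~cⱼ)
    u-covered {u} u∈W | no u≁cₖ | yes u~cⱼ with same w∈W u∈W w~cₖ u~cⱼ
    ...   | refl = contradiction w~cₖ u≁cₖ
    u-covered {u} u∈W | no u≁cₖ | no u≁cⱼ with centre-neighbour O u∈W p
    ...   | _ , here refl , _ , p≢p = contradiction refl p≢p
    ...   | _ , there (here refl) , u~cₖ , _ = contradiction u~cₖ u≁cₖ
    ...   | _ , there (there (here refl)) , u~cⱼ , _ = contradiction u~cⱼ u≁cⱼ
    ...   | _ , there (there (there c∈)) , u~c , _ = inj₁ (lose c∈ u~c)

  -- A leaf whose centre is also free can be turned into a centre, which leads back to `no-free₁`,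
  -- from the side of p or of q. What is left is that p and q see the same leaf, or two leaves whose
  -- centres both have unmatched neighbours.
  no-free₂ : ∀ {p q cₖ lₖ R W} → Oriented ((p , q) ∷ (cₖ , lₖ) ∷ R) W → Free W p → p ~ lₖ →
             lₖ ≢ q → ⊥
  no-free₂ {p} {q} {cₖ} {lₖ} {R} {W} O free p~lₖ lₖ≢q with free? W cₖ
  ... | inj₁ cₖ-free = no-free₁ (reorderᴼ (swap _ _ ↭-refl)
          (flipᴼ cₖ-free (reorderᴼ (swap _ _ ↭-refl) O))) free p~lₖ lₖ≢q (here refl)
  ... | inj₂ (w , w∈W , w~cₖ) with leaf-neighbour O (here refl) p
  ... | _  , inj₁ (here refl) , q~q , _ = ~-irrefl q~q
  ... | _  , inj₂ (here refl) , _ , q′≢p = q′≢p refl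
  ... | q′ , inj₂ (there q′∈) , q~q′ , q′≢p = no-free₁ (flipᴼ free O) (All.head (leavesFree O)) q~q′ q′≢p q′∈
  ... | _ , inj₁ (there (here refl)) , q~lₖ , _ with pick w∈W
  -- Matching cₖ to w instead of lₖ leaves lₖ unmatched, at the tip of a triangle over pq.
  ...   | W′ , W↭ = triangle-free {w = lₖ} {W = lₖ ∷ W′} M (here refl) (~-sym p~lₖ) (~-sym q~lₖ)
    where
    M : Maximum ((p , q) ∷ (w , cₖ) ∷ R) (lₖ ∷ W′)
    M = record
      { isMatching = record
        { areEdges  = edge (isMaximum O) ∷ w~cₖ ∷ All.tail (All.tail (edges O))
        ; partition = ↭-trans
            (solve 8 (λ p q w ck lk L C W → (q ⊕ (ck ⊕ L)) ⊕ ((p ⊕ (w ⊕ C)) ⊕ (lk ⊕ W)) ⊜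
              (q ⊕ (lk ⊕ L)) ⊕ ((p ⊕ (ck ⊕ C)) ⊕ (w ⊕ W))) ↭-refl
              [ p ] [ q ] [ w ] [ cₖ ] [ lₖ ] (leaves R) (centres R) W′)
            (partition (reorderW W↭ (matching O)))
        }
      ; attained = attained (isMaximum O)
      }
  no-free₂ {p} {q} {cₖ} {lₖ} {R} {W} O free p~lₖ lₖ≢q | inj₂ u~cₖ
      | q′ , inj₁ (there (there q′∈)) , q~q′ , q′≢p with ∈-leaves q′∈
  ... | cⱼ , R′ , R↭ with free? W cⱼ
  ...   | inj₂ u~cⱼ = no-free₃ (reorderᴼ (prep _ (prep _ R↭)) O) free p~lₖ q~q′ u~cₖ u~cⱼ
  ...   | inj₁ cⱼ-free = no-free₁
    (reorderᴼ (swap _ _ ↭-refl) (flipᴼ cⱼ-free (reorderᴼ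
      (↭-trans (prep _ (bring R↭)) (swap _ _ ↭-refl)) (flipᴼ free O))))
    (All.head (leavesFree O)) q~q′ q′≢p (here refl)

  no-free : ∀ {p q R W} → Oriented ((p , q) ∷ R) W → ¬ Free W p
  no-free {p} {q} O free with leaf-neighbour (flipᴼ free O) (here refl) q
  ... | _  , inj₁ (here refl) , p~p , _ = ~-irrefl p~p
  ... | _  , inj₂ (here refl) , _ , q≢q = q≢q refl
  ... | p′ , inj₂ (there p′∈) , p~p′ , p′≢q = no-free₁ O free p~p′ p′≢q p′∈
  ... | p′ , inj₁ (there p′∈) , p~p′ , p′≢q with ∈-leaves p′∈
  ...   | cₖ , R′ , R↭ = no-free₂ (reorderᴼ (prep _ R↭) O) free p~p′ p′≢q

  fixed : ∀ {c l R W} → Oriented ((c , l) ∷ R) W → ∃[ u ] u ∈ W × u ~ c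
  fixed {c} {W = W} O with free? W c
  ... | inj₁ free = ⊥-elim (no-free O free)
  ... | inj₂ u    = u

  -- Matched edges pair up through their leaves.

  record Apex (W : List (Fin n)) (c₁ c₂ w : Fin n) : Set where
    constructor mkApex
    field
      member : w ∈ W
      left   : w ~ c₁
      right  : w ~ c₂
      only   : ∀ {u} → u ∈ W → u ~ c₁ ⊎ u ~ c₂ → u ≡ w

  -- Both centres have unmatched neighbours by `fixed`; distinct ones u and u′ would give the
  -- augmenting path u c₁ l₁ l₂ c₂ u′.
  apex : ∀ {c₁ l₁ c₂ l₂ R W} → Oriented ((c₁ , l₁) ∷ (c₂ , l₂) ∷ R) W → l₁ ~ l₂ →
         ∃[ w ] Apex W c₁ c₂ w
  apex {c₁} {l₁} {c₂} {l₂} {R} {W} O l₁~l₂ = from (fixed O) (fixed (reorderᴼ (swap _ _ ↭-refl) O))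
    where
    same : ∀ {u u′} → u ∈ W → u′ ∈ W → u ~ c₁ → u′ ~ c₂ → u ≡ u′
    same {u} {u′} u∈W u′∈W u~c₁ u′~c₂ with u Fin.≟ u′
    ... | yes u≡u′ = u≡u′
    ... | no  u≢u′ = ⊥-elim (no-augmenting ((c₁ , l₁) ∷ (l₂ , c₂) ∷ [])
      (flip-at (_ ∷ []) (isMaximum O)) u∈W u′∈W u≢u′ (u~c₁ , l₁~l₂ , ~-sym u′~c₂))

    from : ∃[ u ] u ∈ W × u ~ c₁ → ∃[ v ] v ∈ W × v ~ c₂ → ∃[ w ] Apex W c₁ c₂ w
    from (u , u∈W , u~c₁) (v , v∈W , v~c₂) with same u∈W v∈W u~c₁ v~c₂
    ... | refl = u , mkApex u∈W u~c₁ v~c₂ (λ x∈W →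
      [ (λ x~c₁ → same x∈W u∈W x~c₁ v~c₂) , (λ x~c₂ → ≡.sym (same u∈W x∈W u~c₁ x~c₂)) ]′)

  -- Otherwise w and l₂ replace the three centres in a dominating set.
  no-leaf-path : ∀ {c₁ l₁ c₂ l₂ c₃ l₃ R W} → Oriented ((c₁ , l₁) ∷ (c₂ , l₂) ∷ (c₃ , l₃) ∷ R) W →
                 l₁ ~ l₂ → ¬ l₂ ~ l₃
  no-leaf-path {c₁} {l₁} {c₂} {l₂} {c₃} {l₃} {R} {W} O l₁~l₂ l₂~l₃
    with apex O l₁~l₂
       | apex (reorderᴼ (↭-trans (swap _ _ ↭-refl) (prep _ (swap _ _ ↭-refl))) O) l₂~l₃
  ... | w , mkApex w∈W w~c₁ w~c₂ only | w′ , mkApex w′∈W w′~c₂ w′~c₃ only′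
    with only w′∈W (inj₂ w′~c₂)
  ... | refl with edges O | pick w∈W
  ... | c₁~l₁ ∷ c₂~l₂ ∷ c₃~l₃ ∷ es | W′ , W↭ =
    uncertifiable {rest = l₁ ∷ l₃ ∷ c₁ ∷ c₂ ∷ c₃ ∷ leaves R ++ W′} {zeros = w ∷ l₂ ∷ centres R}
      (isMaximum O) none
      (↭-trans (solve 10 (λ c1 l1 c2 l2 c3 l3 w L C W →
        (l1 ⊕ (l3 ⊕ (c1 ⊕ (c2 ⊕ (c3 ⊕ (L ⊕ W)))))) ⊕ (w ⊕ (l2 ⊕ C)) ⊜
        (l1 ⊕ (l2 ⊕ (l3 ⊕ L))) ⊕ ((c1 ⊕ (c2 ⊕ (c3 ⊕ C))) ⊕ (w ⊕ W))) ↭-refl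
        [ c₁ ] [ l₁ ] [ c₂ ] [ l₂ ] [ c₃ ] [ l₃ ] [ w ] (leaves R) (centres R) W′)
        (++⁺ˡ (leaves ((c₁ , l₁) ∷ (c₂ , l₂) ∷ (c₃ , l₃) ∷ R))
          (++⁺ˡ (centres ((c₁ , l₁) ∷ (c₂ , l₂) ∷ (c₃ , l₃) ∷ R)) (↭-sym W↭))))
      ( inj₁ (there (here l₁~l₂)) ∷ inj₁ (there (here (~-sym l₂~l₃)))
      ∷ inj₁ (here (~-sym w~c₁)) ∷ inj₁ (here (~-sym w~c₂)) ∷ inj₁ (here (~-sym w′~c₃))
      ∷ All.++⁺ (leaves-covered es (there ∘ there)) (All.tabulate u-covered))
      (≡.cong (3 ℕ.+_) (length-map proj₁ R))
    where
    u-covered : ∀ {u} → u ∈ W′ → Covered (w ∷ l₂ ∷ centres R) [] u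
    u-covered {u} u∈W′ with ∈-resp-↭ (↭-sym W↭) (there u∈W′) | picked-≢ (isMaximum O) W↭ u∈W′
    ... | u∈W | u≢w with centre-neighbour O u∈W u
    ... | _ , here refl , u~c₁ , _ = contradiction (only u∈W (inj₁ u~c₁)) u≢w
    ... | _ , there (here refl) , u~c₂ , _ = contradiction (only u∈W (inj₂ u~c₂)) u≢w
    ... | _ , there (there (here refl)) , u~c₃ , _ = contradiction (only′ u∈W (inj₂ u~c₃)) u≢w
    ... | _ , there (there (there c∈)) , u~c , _ = inj₁ (there (there (lose c∈ u~c)))

  -- Otherwise w, l₁ and l₃ replace the four centres in a dominating set.
  no-shared-apex : ∀ {c₁ l₁ c₂ l₂ c₃ l₃ c₄ l₄ R W w} →
    Oriented ((c₁ , l₁) ∷ (c₂ , l₂) ∷ (c₃ , l₃) ∷ (c₄ , l₄) ∷ R) W →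
    l₁ ~ l₂ → l₃ ~ l₄ → w ∈ W → w ~ c₁ → ¬ w ~ c₃
  no-shared-apex {c₁} {l₁} {c₂} {l₂} {c₃} {l₃} {c₄} {l₄} {R} {W} {w} O l₁~l₂ l₃~l₄ w∈W w~c₁ w~c₃
    with apex O l₁~l₂
       | apex (reorderᴼ (++⁺ʳ R (++-comm ((c₁ , l₁) ∷ (c₂ , l₂) ∷ []) ((c₃ , l₃) ∷ (c₄ , l₄) ∷ []))) O) l₃~l₄
  ... | w₁ , mkApex _ _ w₁~c₂ only | w₂ , mkApex _ _ w₂~c₄ only′
    with only w∈W (inj₁ w~c₁) | only′ w∈W (inj₁ w~c₃)
  ... | refl | refl with edges O | pick w∈W
  ... | c₁~l₁ ∷ c₂~l₂ ∷ c₃~l₃ ∷ c₄~l₄ ∷ es | W′ , W↭ =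
    uncertifiable {rest = c₁ ∷ c₂ ∷ c₃ ∷ c₄ ∷ l₂ ∷ l₄ ∷ leaves R ++ W′} {zeros = w ∷ l₁ ∷ l₃ ∷ centres R}
      (isMaximum O) none
      (↭-trans (solve 12 (λ c1 l1 c2 l2 c3 l3 c4 l4 w L C W →
        (c1 ⊕ (c2 ⊕ (c3 ⊕ (c4 ⊕ (l2 ⊕ (l4 ⊕ (L ⊕ W))))))) ⊕ (w ⊕ (l1 ⊕ (l3 ⊕ C))) ⊜
        (l1 ⊕ (l2 ⊕ (l3 ⊕ (l4 ⊕ L)))) ⊕ ((c1 ⊕ (c2 ⊕ (c3 ⊕ (c4 ⊕ C)))) ⊕ (w ⊕ W))) ↭-refl
        [ c₁ ] [ l₁ ] [ c₂ ] [ l₂ ] [ c₃ ] [ l₃ ] [ c₄ ] [ l₄ ] [ w ] (leaves R) (centres R) W′)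
        (++⁺ˡ (leaves ((c₁ , l₁) ∷ (c₂ , l₂) ∷ (c₃ , l₃) ∷ (c₄ , l₄) ∷ R))
          (++⁺ˡ (centres ((c₁ , l₁) ∷ (c₂ , l₂) ∷ (c₃ , l₃) ∷ (c₄ , l₄) ∷ R)) (↭-sym W↭))))
      ( inj₁ (here (~-sym w~c₁)) ∷ inj₁ (here (~-sym w₁~c₂))
      ∷ inj₁ (here (~-sym w~c₃)) ∷ inj₁ (here (~-sym w₂~c₄))
      ∷ inj₁ (there (here (~-sym l₁~l₂))) ∷ inj₁ (there (there (here (~-sym l₃~l₄))))
      ∷ All.++⁺ (leaves-covered es (there ∘ there ∘ there)) (All.tabulate u-covered))
      (≡.cong (4 ℕ.+_) (length-map proj₁ R))
    where
    u-covered : ∀ {u} → u ∈ W′ → Covered (w ∷ l₁ ∷ l₃ ∷ centres R) [] u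
    u-covered {u} u∈W′ with ∈-resp-↭ (↭-sym W↭) (there u∈W′) | picked-≢ (isMaximum O) W↭ u∈W′
    ... | u∈W | u≢w with centre-neighbour O u∈W u
    ... | _ , here refl , u~c₁ , _ = contradiction (only u∈W (inj₁ u~c₁)) u≢w
    ... | _ , there (here refl) , u~c₂ , _ = contradiction (only u∈W (inj₂ u~c₂)) u≢w
    ... | _ , there (there (here refl)) , u~c₃ , _ = contradiction (only′ u∈W (inj₁ u~c₃)) u≢w
    ... | _ , there (there (there (here refl))) , u~c₄ , _ = contradiction (only′ u∈W (inj₂ u~c₄)) u≢w
    ... | _ , there (there (there (there c∈))) , u~c , _ = inj₁ (there (there (there (lose c∈ u~c))))

  -- The second neighbour of lᵣ decides. A centre gives a cherry. If it is lⱼ, rematching as lⱼlᵣ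
  -- and wcⱼ puts the unmatched cᵣ on a triangle. If it is a third leaf lₛ, the apex w of cᵣ and cₛ
  -- either sees cⱼ, which gives a house, or ends an augmenting path that starts at an unmatched
  -- neighbour of cⱼ.
  no-leaf-centre : ∀ {cⱼ lⱼ cᵣ lᵣ R W} → Oriented ((cⱼ , lⱼ) ∷ (cᵣ , lᵣ) ∷ R) W → ¬ lⱼ ~ cᵣ
  no-leaf-centre {cⱼ} {lⱼ} {cᵣ} {lᵣ} {R} {W} O lⱼ~cᵣ with leaf-neighbour O (there (here refl)) cᵣ
  ... | _ , inj₂ d∈ , lᵣ~d , d≢cᵣ = no-cherry O lⱼ~cᵣ lᵣ~d d∈ d≢cᵣ
  ... | _ , inj₁ (there (here refl)) , lᵣ~lᵣ , _ = ~-irrefl lᵣ~lᵣ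
  ... | _ , inj₁ (here refl) , lᵣ~lⱼ , _ with apex O (~-sym lᵣ~lⱼ)
  ...   | w , mkApex w∈W w~cⱼ _ _ with pick w∈W
  ...   | W′ , W↭ = triangle-free {w = cᵣ} {W = cᵣ ∷ W′} M (here refl)
    (~-sym lⱼ~cᵣ) (All.head (All.tail (edges O)))
    where
    M : Maximum ((lⱼ , lᵣ) ∷ (w , cⱼ) ∷ R) (cᵣ ∷ W′)
    M = record
      { isMatching = record
        { areEdges  = ~-sym lᵣ~lⱼ ∷ w~cⱼ ∷ All.tail (All.tail (edges O))
        ; partition = ↭-trans
            (solve 8 (λ cj lj cr lr w L C W → (lr ⊕ (cj ⊕ L)) ⊕ ((lj ⊕ (w ⊕ C)) ⊕ (cr ⊕ W)) ⊜
              (lj ⊕ (lr ⊕ L)) ⊕ ((cj ⊕ (cr ⊕ C)) ⊕ (w ⊕ W))) ↭-refl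
              [ cⱼ ] [ lⱼ ] [ cᵣ ] [ lᵣ ] [ w ] (leaves R) (centres R) W′)
            (partition (reorderW W↭ (matching O)))
        }
      ; attained = attained (isMaximum O)
      }
  no-leaf-centre {cⱼ} {lⱼ} {cᵣ} {lᵣ} {R} {W} O lⱼ~cᵣ | lₛ , inj₁ (there (there lₛ∈)) , lᵣ~lₛ , _
    with ∈-leaves lₛ∈
  ... | cₛ , R′ , R↭ with reorderᴼ (prep _ (prep _ R↭)) O
  ... | O′ with apex (reorderᴼ (↭-trans (swap _ _ ↭-refl) (prep _ (swap _ _ ↭-refl))) O′) lᵣ~lₛ
  ... | w , mkApex w∈W w~cᵣ w~cₛ only with w ~? cⱼ | fixed O
  ... | no w≁cⱼ | u , u∈W , u~cⱼ = no-augmenting ((cⱼ , lⱼ) ∷ (cᵣ , lᵣ) ∷ (lₛ , cₛ) ∷ [])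
    (flip-at (_ ∷ _ ∷ []) (isMaximum O′)) u∈W w∈W (λ { refl → w≁cⱼ u~cⱼ })
    (u~cⱼ , lⱼ~cᵣ , lᵣ~lₛ , ~-sym w~cₛ)
  ... | yes w~cⱼ | _ = no-house
    (reorderᴼ (↭-trans (swap _ _ ↭-refl) (prep _ (swap _ _ ↭-refl))) O′) lᵣ~lₛ lⱼ~cᵣ u-covered
    where
    u-covered : ∀ {u} → u ∈ W → Any (u ~_) (centres R′) ⊎ (u ~ cⱼ × (u ~ cᵣ ⊎ u ~ cₛ))
    u-covered {u} u∈W with u Fin.≟ w
    ... | yes refl = inj₂ (w~cⱼ , inj₁ w~cᵣ)
    ... | no  u≢w with centre-neighbour O′ u∈W cⱼ
    ...   | _ , here refl , _ , c≢cⱼ = contradiction refl c≢cⱼ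
    ...   | _ , there (here refl) , u~cᵣ , _ = contradiction (only u∈W (inj₁ u~cᵣ)) u≢w
    ...   | _ , there (there (here refl)) , u~cₛ , _ = contradiction (only u∈W (inj₂ u~cₛ)) u≢w
    ...   | _ , there (there (there c∈)) , u~c , _ = inj₁ (lose c∈ u~c)

  leaf≁centre : ∀ {c l R W d} → Oriented ((c , l) ∷ R) W → d ∈ centres R → ¬ l ~ d
  leaf≁centre O d∈ with ∈-centres d∈
  ... | _ , _ , R↭ = no-leaf-centre (reorderᴼ (prep _ R↭) O)

  leaf-partner : ∀ {c l R W} → Oriented ((c , l) ∷ R) W → ∃[ l′ ] l′ ∈ leaves R × l ~ l′
  leaf-partner {c} O with leaf-neighbour O (here refl) c
  ... | _  , inj₁ (here refl) , l~l  , _   = contradiction l~l ~-irrefl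
  ... | l′ , inj₁ (there l′∈) , l~l′ , _   = l′ , l′∈ , l~l′
  ... | _  , inj₂ (here refl) , _    , c≢c = contradiction refl c≢c
  ... | _  , inj₂ (there d∈)  , l~d  , _   = contradiction l~d (leaf≁centre O d∈)

  module _ {c₁ l₁ c₂ l₂ R W} (O : Oriented ((c₁ , l₁) ∷ (c₂ , l₂) ∷ R) W) (l₁~l₂ : l₁ ~ l₂) where

    private
      O′ : Oriented ((c₂ , l₂) ∷ (c₁ , l₁) ∷ R) W
      O′ = reorderᴼ (swap _ _ ↭-refl) O

    -- The partner of l₃ is neither l₁ nor l₂, as either would produce a path of three leaves; so
    -- the pairing respects the pair already chosen.
    other-partner : ∀ {c₃ l₃ R′} → R ↭ (c₃ , l₃) ∷ R′ → ∃[ c₄ ] ∃[ l₄ ] ∃[ R″ ]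
                    R ↭ (c₃ , l₃) ∷ (c₄ , l₄) ∷ R″ × l₃ ~ l₄
    other-partner {c₃} {l₃} R↭ with leaf-partner (reorderᴼ
      (↭-trans (prep _ (prep _ R↭)) (↭-trans (prep _ (swap _ _ ↭-refl)) (swap _ _ ↭-refl))) O)
    ... | _ , here refl , l₃~l₁ = contradiction (~-sym l₃~l₁)
      (no-leaf-path (reorderᴼ (prep _ (prep _ R↭)) O′) (~-sym l₁~l₂))
    ... | _ , there (here refl) , l₃~l₂ = contradiction (~-sym l₃~l₂)
      (no-leaf-path (reorderᴼ (prep _ (prep _ R↭)) O) l₁~l₂)
    ... | l₄ , there (there l₄∈) , l₃~l₄ with ∈-leaves l₄∈
    ...   | c₄ , R″ , R′↭ = c₄ , l₄ , R″ , ↭-trans R↭ (prep _ R′↭) , l₃~l₄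

    leaf-closed : ∀ {v} → l₁ ~ v → v ≡ c₁ ⊎ v ≡ l₂
    leaf-closed {v} l₁~v with cover (matching O) v
    ... | inj₁ (here refl) = contradiction l₁~v ~-irrefl
    ... | inj₁ (there (here refl)) = inj₂ refl
    ... | inj₁ (there (there v∈)) with ∈-leaves v∈
    ...   | _ , _ , R↭ = contradiction l₁~v (no-leaf-path (reorderᴼ (prep _ (prep _ R↭)) O′) (~-sym l₁~l₂))
    leaf-closed l₁~v | inj₂ (inj₁ (here refl)) = inj₁ refl
    leaf-closed l₁~v | inj₂ (inj₁ (there v∈)) = contradiction l₁~v (leaf≁centre O v∈)
    leaf-closed l₁~v | inj₂ (inj₂ v∈W) = contradiction (~-sym l₁~v) (leaf-free O (here refl) v∈W)

    module _ {w} (w-apex : Apex W c₁ c₂ w) where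

      open Apex w-apex renaming (member to w∈W; left to w~c₁; right to w~c₂)

      apex-closed : ∀ {v} → w ~ v → v ≡ c₁ ⊎ v ≡ c₂
      apex-closed {v} w~v with cover (matching O) v
      ... | inj₁ v∈ = contradiction w~v (leaf-free O v∈ w∈W)
      ... | inj₂ (inj₁ (here refl)) = inj₁ refl
      ... | inj₂ (inj₁ (there (here refl))) = inj₂ refl
      ... | inj₂ (inj₂ v∈W) = contradiction w~v (independent (isMaximum O) w∈W v∈W)
      ... | inj₂ (inj₁ (there (there v∈))) with ∈-centres v∈
      ...   | _ , _ , R↭ with other-partner R↭
      ...     | _ , _ , _ , R↭′ , l₃~l₄ = contradiction w~v
        (no-shared-apex (reorderᴼ (prep _ (prep _ R↭′)) O) l₁~l₂ l₃~l₄ w∈W w~c₁)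

      centre-closed : ∀ {v} → c₁ ~ v → v ≡ l₁ ⊎ v ≡ w
      centre-closed {v} c₁~v with cover (matching O) v
      ... | inj₁ (here refl) = inj₁ refl
      ... | inj₁ (there (here refl)) = contradiction (~-sym c₁~v) (leaf≁centre O′ (here refl))
      ... | inj₁ (there (there v∈)) with ∈-leaves v∈
      ...   | _ , _ , R↭ = contradiction (~-sym c₁~v) (leaf≁centre
        (reorderᴼ (↭-trans (prep _ (bring R↭)) (swap _ _ ↭-refl)) O) (here refl))
      centre-closed c₁~v | inj₂ (inj₂ v∈W) = inj₂ (only v∈W (inj₁ (~-sym c₁~v)))
      centre-closed c₁~v | inj₂ (inj₁ (here refl)) = contradiction c₁~v ~-irrefl
      -- Rematching the four endpoints as c₁c₂ and l₁l₂ puts the unmatched w on a triangle.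
      centre-closed c₁~v | inj₂ (inj₁ (there (here refl))) =
        contradiction w~c₂ (triangle-free {a = c₁} {b = c₂} M w∈W w~c₁)
        where
        M : Maximum ((c₁ , c₂) ∷ (l₁ , l₂) ∷ R) W
        M = record
          { isMatching = record
            { areEdges  = c₁~v ∷ l₁~l₂ ∷ All.tail (All.tail (edges O))
            ; partition = ↭-trans
                (solve 7 (λ c1 l1 c2 l2 L C W → (c2 ⊕ (l2 ⊕ L)) ⊕ ((c1 ⊕ (l1 ⊕ C)) ⊕ W) ⊜
                  (l1 ⊕ (l2 ⊕ L)) ⊕ ((c1 ⊕ (c2 ⊕ C)) ⊕ W)) ↭-refl
                  [ c₁ ] [ l₁ ] [ c₂ ] [ l₂ ] (leaves R) (centres R) W)
                (partition (matching O))
            }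
          ; attained = attained (isMaximum O)
          }
      centre-closed {v} c₁~v | inj₂ (inj₁ (there (there v∈))) with ∈-centres v∈
      ... | l₃ , _ , R↭ with other-partner R↭
      ... | c₄ , l₄ , R″ , R↭′ , l₃~l₄ with reorderᴼ (prep _ (prep _ R↭′)) O
      ... | Oᴿ with apex (reorderᴼ (++⁺ʳ R″ (++-comm e₁₂ e₃₄)) Oᴿ) l₃~l₄
        where
        e₁₂ = (c₁ , l₁) ∷ (c₂ , l₂) ∷ []
        e₃₄ = (v , l₃) ∷ (c₄ , l₄) ∷ []
      -- The path w c₂ l₂ l₁ c₁ v l₃ l₄ c₄ w′ runs through both pairs; its ends differ because two
      -- pairs cannot share an apex.
      ... | w′ , mkApex w′∈W w′~c₃ w′~c₄ _ = ⊥-elim (no-augmenting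
        ((c₂ , l₂) ∷ (l₁ , c₁) ∷ (v , l₃) ∷ (l₄ , c₄) ∷ [])
        (flip-at ((c₂ , l₂) ∷ []) (flip-at ((c₂ , l₂) ∷ (c₁ , l₁) ∷ (v , l₃) ∷ [])
          (reorderᴹ (swap _ _ ↭-refl) (isMaximum Oᴿ))))
        w∈W w′∈W (λ { refl → no-shared-apex Oᴿ l₁~l₂ l₃~l₄ w∈W w~c₁ w′~c₃ })
        (w~c₂ , ~-sym l₁~l₂ , c₁~v , l₃~l₄ , ~-sym w′~c₄))

  Apex-swap : ∀ {W c₁ c₂ w} → Apex W c₁ c₂ w → Apex W c₂ c₁ w
  Apex-swap (mkApex w∈W w~c₁ w~c₂ only) = mkApex w∈W w~c₂ w~c₁ (λ u∈W → only u∈W ∘ [ inj₂ , inj₁ ]′)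

  pentagon : ∀ {c₁ l₁ c₂ l₂ R W w} → Oriented ((c₁ , l₁) ∷ (c₂ , l₂) ∷ R) W → l₁ ~ l₂ →
             Apex W c₁ c₂ w → PentagonComponent G
  pentagon {c₁} {l₁} {c₂} {l₂} {R} {W} {w} O l₁~l₂ w-apex@(mkApex w∈W w~c₁ w~c₂ _) = record
    { at        = lookup vertices
    ; injective = lookup-injective vertices! _ _
    ; succ-edge = λ { 0F → w~c₁ ; 1F → All.head (edges O) ; 2F → l₁~l₂
                    ; 3F → ~-sym (All.head (All.tail (edges O))) ; 4F → ~-sym w~c₂ }
    ; closed    = closed
    }
    where
    flip⊎ : ∀ {A B : Set} → A ⊎ B → B ⊎ A
    flip⊎ = [ inj₂ , inj₁ ]′

    vertices : List (Fin n)
    vertices = w ∷ c₁ ∷ l₁ ∷ l₂ ∷ c₂ ∷ []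

    O′ : Oriented ((c₂ , l₂) ∷ (c₁ , l₁) ∷ R) W
    O′ = reorderᴼ (swap _ _ ↭-refl) O

    closed : ∀ a {v} → lookup vertices a ~ v →
             v ≡ lookup vertices (succ₅ a) ⊎ v ≡ lookup vertices (pred₅ a)
    closed 0F w~v = apex-closed O l₁~l₂ w-apex w~v
    closed 1F c~v = centre-closed O l₁~l₂ w-apex c~v
    closed 2F l~v = flip⊎ (leaf-closed O l₁~l₂ l~v)
    closed 3F l~v = leaf-closed O′ (~-sym l₁~l₂) l~v
    closed 4F c~v = flip⊎ (centre-closed O′ (~-sym l₁~l₂) (Apex-swap w-apex) c~v)

    vertices! : Unique vertices
    vertices! with pick w∈W
    ... | W′ , W↭ = Unique.take⁺ {xs = vertices ++ rest} 5
      (Unique-resp-↭ to-front (unique (reorderW W↭ (matching O))))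
      where
      rest = leaves R ++ centres R ++ W′
      to-front : (l₁ ∷ l₂ ∷ leaves R) ++ (c₁ ∷ c₂ ∷ centres R) ++ w ∷ W′ ↭ vertices ++ rest
      to-front = solve 8 (λ c1 l1 c2 l2 w L C W → (l1 ⊕ (l2 ⊕ L)) ⊕ ((c1 ⊕ (c2 ⊕ C)) ⊕ (w ⊕ W)) ⊜
        (w ⊕ (c1 ⊕ (l1 ⊕ (l2 ⊕ (c2 ⊕ (L ⊕ (C ⊕ W)))))))) ↭-refl
        [ c₁ ] [ l₁ ] [ c₂ ] [ l₂ ] [ w ] (leaves R) (centres R) W′

  -- Fixing the positions of centre and leaf, and sending every unmatched neighbour of the centre to
  -- position 0, is enough to place vertices of all three kinds.
  PentagonAt : Fin n → Fin n → List (Fin n) → Set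
  PentagonAt c l W = ∃[ p ] let open PentagonComponent {G = G} p in
    at 1F ≡ c × at 2F ≡ l × (∀ {u} → u ∈ W → u ~ c → u ≡ at 0F)

  pentagon-at : ∀ {c l R W} → Oriented ((c , l) ∷ R) W → PentagonAt c l W
  pentagon-at {c} {l} {W = W} O with leaf-partner O
  ... | l₂ , l₂∈ , l~l₂ with ∈-leaves l₂∈
  ... | c₂ , R′ , R↭ = from (apex O′ l~l₂)
    where
    O′ = reorderᴼ (prep _ R↭) O
    from : ∃[ w ] Apex W c c₂ w → PentagonAt c l W
    from (w , w-apex) = pentagon O′ l~l₂ w-apex , refl , refl , λ u∈W u~c → Apex.only w-apex u∈W (inj₁ u~c)

  InPentagon : Fin n → Set
  InPentagon v = ∃[ p ] ∃[ a ] v ≡ PentagonComponent.at {G = G} p a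

  leaf-in-pentagon : ∀ {E W v} → Oriented E W → v ∈ leaves E → InPentagon v
  leaf-in-pentagon O v∈ with ∈-leaves v∈
  ... | _ , _ , E↭ = from (pentagon-at (reorderᴼ E↭ O))
    where
    from : ∀ {c l W} → PentagonAt c l W → InPentagon l
    from (p , _ , eq , _) = p , 2F , ≡.sym eq

  centre-in-pentagon : ∀ {E W v} → Oriented E W → v ∈ centres E → InPentagon v
  centre-in-pentagon O v∈ with ∈-centres v∈
  ... | _ , _ , E↭ = from (pentagon-at (reorderᴼ E↭ O))
    where
    from : ∀ {c l W} → PentagonAt c l W → InPentagon c
    from (p , eq , _) = p , 1F , ≡.sym eq

  unmatched-in-pentagon : ∀ {E W v} → Oriented E W → v ∈ W → InPentagon v
  unmatched-in-pentagon {v = v} O v∈W with centre-neighbour O v∈W v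
  ... | c , c∈ , v~c , _ with ∈-centres c∈
  ... | _ , _ , E↭ = from (pentagon-at (reorderᴼ E↭ O)) v∈W v~c
    where
    from : ∀ {c l W v} → PentagonAt c l W → v ∈ W → v ~ c → InPentagon v
    from (p , _ , _ , only) v∈W v~c = p , 0F , only v∈W v~c

  every-vertex : ∀ {E W} → Maximum E W → ∀ v → InPentagon v
  every-vertex M v = from (oriented M)
    where
    from : ∀ {W} → ∃[ E ] Oriented E W → InPentagon v
    from (E , O) = [ leaf-in-pentagon O , [ centre-in-pentagon O , unmatched-in-pentagon O ]′ ]′
      (cover (matching O) v)

-- A graph covered by pentagon components is a disjoint union of them.

module PentagonCover {n} (G : Graph (Fin n))
  (every-vertex : ∀ v → ∃[ p ] ∃[ a ] v ≡ PentagonComponent.at {G = G} p a) where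

  open Certificates G
  open PentagonComponent {G = G}

  abstract
    cells : PentagonComponent G → List (Fin n)
    cells p = List.tabulate (at p)

    at∈cells : ∀ p a → at p a ∈ cells p
    at∈cells p a = ∈-tabulate⁺ {f = at p} a

    cells⁻ : ∀ p {v} → v ∈ cells p → ∃[ a ] v ≡ at p a
    cells⁻ p = ∈-tabulate⁻ {f = at p}

    cells-unique : ∀ p → Unique (cells p)
    cells-unique p = Unique.tabulate⁺ (injective p)

    length-cells : ∀ p → length (cells p) ≡ 5
    length-cells p = length-tabulate (at p)

  -- A set closed under taking neighbours is a union of components.
  walk : ∀ {X : Fin n → Set} → (∀ {u v} → u ~ v → X u → X v) → ∀ p a b → X (at p a) → X (at p b)
  walk {X} step p a b = from-0 b ∘ to-0 a
    where
    next : ∀ a → X (at p a) → X (at p (succ₅ a))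
    next a = step (succ-edge p a)
    to-0 : ∀ a → X (at p a) → X (at p 0F)
    to-0 0F = id
    to-0 1F = next 4F ∘ next 3F ∘ next 2F ∘ next 1F
    to-0 2F = next 4F ∘ next 3F ∘ next 2F
    to-0 3F = next 4F ∘ next 3F
    to-0 4F = next 4F
    from-0 : ∀ a → X (at p 0F) → X (at p a)
    from-0 0F = id
    from-0 1F = next 0F
    from-0 2F = next 1F ∘ next 0F
    from-0 3F = next 2F ∘ next 1F ∘ next 0F
    from-0 4F = next 3F ∘ next 2F ∘ next 1F ∘ next 0F

  cells-closed : ∀ p {u v} → u ~ v → u ∈ cells p → v ∈ cells p
  cells-closed p u~v u∈ with cells⁻ p u∈
  ... | a , refl with closed p a u~v
  ... | inj₁ refl = at∈cells p (succ₅ a)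
  ... | inj₂ refl = at∈cells p (pred₅ a)

  all-cells : List (PentagonComponent G) → List (Fin n)
  all-cells = concatMap cells

  all-cells-closed : ∀ ps {u v} → u ~ v → u ∈ all-cells ps → v ∈ all-cells ps
  all-cells-closed (p ∷ ps) u~v u∈ with ∈-++⁻ (cells p) u∈
  ... | inj₁ u∈p  = ∈-++⁺ˡ (cells-closed p u~v u∈p)
  ... | inj₂ u∈ps = ∈-++⁺ʳ (cells p) (all-cells-closed ps u~v u∈ps)

  disjoint : ∀ {xs ys : List (Fin n)} → Unique (xs ++ ys) → ∀ {u v} → u ∈ xs → v ∈ ys → u ≢ v
  disjoint {x ∷ xs} (x∉ ∷ _) (here refl) v∈ = All.lookup x∉ (∈-++⁺ʳ xs v∈)
  disjoint {x ∷ xs} (_ ∷ u)  (there u∈)  v∈ = disjoint u u∈ v∈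

  -- The cells already removed are closed under adjacency. Had one vertex of q been among them,
  -- walking round q would bring `at q a` there too.
  cells-remain : ∀ {q a L ps} → Unique (L ++ all-cells ps) → (∀ v → v ∈ L ++ all-cells ps) →
                 at q a ∈ L → ∀ {u} → u ∈ cells q → u ∈ L
  cells-remain {q} {a} {L} {ps} L! all∈ qa∈L u∈ with cells⁻ q u∈
  ... | b , refl with ∈-++⁻ L (all∈ (at q b))
  ... | inj₁ i = i
  ... | inj₂ i = contradiction refl (disjoint L! qa∈L (walk (all-cells-closed ps) q b a i))

  peel : ∀ {ps v L} → v ∷ L ++ all-cells ps ↭ allFin n →
         ∃[ q ] ∃[ L′ ] length L′ ℕ.≤ length L × L′ ++ all-cells (q ∷ ps) ↭ allFin n
  peel {ps} {v} {L} p with every-vertex v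
  ... | q , a , v≡ with complement (cells-unique q) (cells-remain {q} {a} {v ∷ L} {ps}
    (Unique-resp-↭ (↭-sym p) (Unique.allFin⁺ n)) (λ u → ∈-resp-↭ (↭-sym p) (∈-allFin u)) (here (≡.sym v≡)))
  ... | L′ , L↭ = q , L′ , shorter , ↭-trans
    (↭-trans (↭-sym (++-assoc L′ (cells q) (all-cells ps)))
      (++⁺ʳ (all-cells ps) (↭-trans (++-comm L′ (cells q)) L↭))) p
    where
    5+ : 5 ℕ.+ length L′ ≡ suc (length L)
    5+ = ≡.trans (≡.cong (ℕ._+ length L′) (≡.sym (length-cells q)))
      (≡.trans (≡.sym (length-++ (cells q))) (↭-length L↭))

    shorter : length L′ ℕ.≤ length L
    shorter = ℕ.≤-trans (ℕ.m≤n+m (length L′) 4) (ℕ.≤-reflexive (ℕ.suc-injective 5+))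

  -- `k` only bounds the length of `L`, which makes the recursion structural although each round
  -- removes five vertices.
  exhaust : ∀ k ps L → length L ℕ.≤ k → L ++ all-cells ps ↭ allFin n →
            ∃[ ps′ ] all-cells ps′ ↭ allFin n
  exhaust k       ps []      _          p = ps , p
  exhaust (suc k) ps (v ∷ L) (ℕ.s≤s ≤k) p with peel {ps} p
  ... | q , L′ , L′≤L , p′ = exhaust k (q ∷ ps) L′ (ℕ.≤-trans L′≤L ≤k) p′

  module _ (ps : List (PentagonComponent G)) where

    vertex : Fin (length ps) × Fin 5 → Fin n
    vertex (i , a) = at (lookup ps i) a

  locate : ∀ ps {v} → v ∈ all-cells ps → ∃[ x ] vertex ps x ≡ v
  locate (p ∷ ps) v∈ with ∈-++⁻ (cells p) v∈
  ... | inj₁ v∈p with cells⁻ p v∈p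
  ...   | a , refl = (zero , a) , refl
  locate (p ∷ ps) v∈ | inj₂ v∈ps with locate ps v∈ps
  ...   | (i , a) , refl = (suc i , a) , refl

  vertex∈ : ∀ ps x → vertex ps x ∈ all-cells ps
  vertex∈ (p ∷ ps) (zero  , a) = ∈-++⁺ˡ (at∈cells p a)
  vertex∈ (p ∷ ps) (suc i , a) = ∈-++⁺ʳ (cells p) (vertex∈ ps (i , a))

  vertex-injective : ∀ ps → Unique (all-cells ps) → ∀ x y → vertex ps x ≡ vertex ps y → x ≡ y
  vertex-injective (p ∷ ps) u (zero , a) (zero , b) eq = ≡.cong (zero ,_) (injective p eq)
  vertex-injective (p ∷ ps) u (suc i , a) (suc j , b) eq
    with vertex-injective ps (Unique-++⁻ʳ (cells p) u) (i , a) (j , b) eq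
  ... | refl = refl
  vertex-injective (p ∷ ps) u (zero , a) (suc j , b) eq = contradiction eq
    (disjoint u (at∈cells p a) (vertex∈ ps (j , b)))
  vertex-injective (p ∷ ps) u (suc i , a) (zero , b) eq = contradiction (≡.sym eq)
    (disjoint u (at∈cells p b) (vertex∈ ps (i , a)))

  at-adj : ∀ p a b → adj G (at p a) (at p b) ≡ adj C₅ a b
  at-adj p a b with adj C₅ a b in eq
  ... | true with C₅-neighbours a b eq
  ...   | inj₁ refl = succ-edge p a
  ...   | inj₂ refl = ≡.trans (adj-sym G (at p a) (at p b))
    (≡.subst (λ c → adj G (at p b) (at p c) ≡ true) (succ-pred a) (succ-edge p b))
    where
    succ-pred : ∀ a → succ₅ (pred₅ a) ≡ a
    succ-pred = from-yes (Fin.all? λ a → succ₅ (pred₅ a) Fin.≟ a)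
  at-adj p a b | false with adj G (at p a) (at p b) in a~b
  ... | false = refl
  ... | true with closed p a a~b
  ...   | inj₁ b≡ with injective p b≡
  ...     | refl with ≡.trans (≡.sym eq) (C₅-succ a)
  ...       | ()
  at-adj p a b | false | true | inj₂ b≡ with injective p b≡
  ...     | refl with ≡.trans (≡.sym eq) (C₅-pred a)
  ...       | ()

  ≅-copies : ∃[ k ] G ≅ k copiesOf C₅
  ≅-copies with exhaust n [] (allFin n) (ℕ.≤-reflexive (length-tabulate id)) (++-identityʳ (allFin n))
  ... | ps , ps↭ = length ps , mk↔ₛ′ to (vertex ps) to-vertex vertex-to , adj≡
    where
    ps! : Unique (all-cells ps)
    ps! = Unique-resp-↭ (↭-sym ps↭) (Unique.allFin⁺ n)

    located : ∀ v → ∃[ x ] vertex ps x ≡ v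
    located v = locate ps (∈-resp-↭ (↭-sym ps↭) (∈-allFin v))

    to : Fin n → Fin (length ps) × Fin 5
    to = proj₁ ∘ located

    vertex-to : ∀ v → vertex ps (to v) ≡ v
    vertex-to = proj₂ ∘ located

    to-vertex : ∀ x → to (vertex ps x) ≡ x
    to-vertex x = vertex-injective ps ps! _ x (vertex-to (vertex ps x))

    vertex-adj : ∀ x y → adj G (vertex ps x) (vertex ps y) ≡ adj (length ps copiesOf C₅) x y
    vertex-adj (i , a) (j , b) with i Fin.≟ j
    ... | yes refl = at-adj (lookup ps i) a b
    ... | no  i≢j with adj G (vertex ps (i , a)) (vertex ps (j , b)) in a~b
    ...   | false = refl
    ...   | true with closed (lookup ps i) a a~b
    ...     | inj₁ eq = contradiction (≡.cong proj₁ (vertex-injective ps ps! (i , _) (j , b) (≡.sym eq))) i≢j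
    ...     | inj₂ eq = contradiction (≡.cong proj₁ (vertex-injective ps ps! (i , _) (j , b) (≡.sym eq))) i≢j

    adj≡ : ∀ u v → adj G u v ≡ adj (length ps copiesOf C₅) (to u) (to v)
    adj≡ u v = ≡.trans (≡.sym (≡.cong₂ (adj G) (vertex-to u) (vertex-to v))) (vertex-adj (to u) (to v))

-- Translation to and from the degrees and matchings of the statement.

module _ {n} {G : Graph (Fin n)} where
  open Certificates G
  open MaximumMatching G

  another-neighbour : ∀ v → 2 ℕ.≤ degree G v → ∀ u → ∃[ w ] v ~ w × w ≢ u
  another-neighbour v 2≤d u with Fin.any? (λ w → (v ~? w) ×-dec ¬? (w Fin.≟ u))
  ... | yes w = w
  ... | no ¬w = contradiction (ℕ.≤-trans 2≤d (≡.subst (degree G v ℕ.≤_) (∣⁅x⁆∣≡1 u) (p⊆q⇒∣p∣≤∣q∣ N⊆u)))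
    (ℕ.<-irrefl refl)
    where
    N⊆u : neighbours G v ⊆ ⁅ u ⁆
    N⊆u {w} w∈ with w Fin.≟ u
    ... | yes refl = x∈⁅x⁆ u
    ... | no  w≢u  = contradiction
      (w , ≡.trans (≡.sym (lookup∘tabulate (adj G v) w)) ([]=⇒lookup w∈) , w≢u) ¬w

  disjoint⇒unique : ∀ {E} → All IsEdge E → AllPairs Disjoint E → Unique (leaves E ++ centres E)
  disjoint⇒unique []        []       = []
  disjoint⇒unique {(c , l) ∷ E} (c~l ∷ es) (d ∷ ds) =
    Unique-resp-↭ (prep l (↭-sym (shift c (leaves E) (centres E))))
      ( ((λ { refl → ~-irrefl c~l })
        ∷ All.++⁺ (All.map⁺ (All.map (proj₂ ∘ proj₂) d)) (All.map⁺ (All.map (proj₁ ∘ proj₂) d)))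
      ∷ All.++⁺ (All.map⁺ (All.map (proj₂ ∘ proj₁) d)) (All.map⁺ (All.map (proj₁ ∘ proj₁) d))
      ∷ disjoint⇒unique es ds)

  unique⇒disjoint : ∀ {E} → Unique (leaves E ++ centres E) → AllPairs Disjoint E
  unique⇒disjoint {[]}          _  = []
  unique⇒disjoint {(c , l) ∷ E} u with Unique-resp-↭ (prep l (shift c (leaves E) (centres E))) u
  ... | (_ ∷ l∉) ∷ c∉ ∷ u′ = All.tabulate (λ e∈ →
    ( All.lookup c∉ (∈-++⁺ʳ (leaves E) (∈-map⁺ proj₁ e∈)) , All.lookup c∉ (∈-++⁺ˡ (∈-map⁺ proj₂ e∈)))
    , (All.lookup l∉ (∈-++⁺ʳ (leaves E) (∈-map⁺ proj₁ e∈)) , All.lookup l∉ (∈-++⁺ˡ (∈-map⁺ proj₂ e∈))))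
    ∷ unique⇒disjoint u′

  fromMatching : (M : Matching G) → ∃[ W ] IsMatching (Matching.edges M) W
  fromMatching M with complement (disjoint⇒unique edges-~ (Matching.disjoint M)) (λ {v} _ → ∈-allFin v)
    where
    edges-~ : All IsEdge (Matching.edges M)
    edges-~ = All.map (Equivalence.to Bool.T-≡) (Matching.areEdges M)
  ... | W , p = W , record
    { areEdges  = All.map (Equivalence.to Bool.T-≡) (Matching.areEdges M)
    ; partition = ↭-trans (↭-sym (++-assoc (leaves (Matching.edges M)) _ W)) p
    }

  toMatching : ∀ {E W} → IsMatching E W → Matching G
  toMatching {E} {W} M = record
    { edges    = E
    ; areEdges = All.map (Equivalence.from Bool.T-≡) (IsMatching.areEdges M)
    ; disjoint = unique⇒disjoint (Unique-++⁻ˡ (leaves E ++ centres E)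
        (Unique-resp-↭ (↭-sym (++-assoc (leaves E) (centres E) W)) (unique M)))
    }

module _ {n} {G : Graph (Fin n)} where
  all-pentagons : ∀ {ν} → (∀ v → 2 ℕ.≤ degree G v) → IsMatchingNumber G ν →
    (∀ C → ν ℕ.≤ Certificates.Certificate.size {G = G} C) → ∃[ k ] G ≅ k copiesOf C₅
  all-pentagons {ν} δ≥2 ((M , attained) , maximal) ν≤size = PentagonCover.≅-copies G
    (Uncertified.every-vertex G ν (maximal ∘ toMatching) ν≤size (λ v → another-neighbour {G = G} v (δ≥2 v))
      (record { isMatching = proj₂ (fromMatching M) ; attained = attained }))

open import Data.Nat.Base using (ℕ; NonZero; _+_; _≤_)

theorem3p1 : ∀ {c ℓ₁ ℓ₂} (ℝ : RealNumbers c ℓ₁ ℓ₂) →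
    let open RealNumbers ℝ using (0#) in
    let open RealNumbers ℝ using (1#) in
    let open Spectrum ℝ in
    ∀ (n : ℕ) .{{_ : NonZero n}} (G : Graph (Fin n)) →
    (∀ v → 2 ≤ degree G v) →
    (∀ k → 1 ≤ k → ¬ (G ≅ k copiesOf C₅)) →
    ∀ (m ν : ℕ) →
    SignlessLaplacianCount G [ 0# , 1# ⟩ m →
    IsMatchingNumber G ν →
    m + 1 ≤ ν
theorem3p1 ℝ n G δ≥2 ≇kC₅ m ν count isν = ℕ.≮⇒≥ refute
  where
  refute : ¬ ν ℕ.< m + 1
  -- Here ν ≤ m, and m is at most the size of every certificate, so no certificate has fewer than ν
  -- forms.
  refute ν<m+1 = absurd (all-pentagons δ≥2 isν λ C →
    ℕ.≤-trans ν≤m (CertificateBound.certificate⇒count≤ ℝ G C count))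
    where
    ν≤m : ν ≤ m
    ν≤m = ℕ.s≤s⁻¹ (≡.subst (ν ℕ.<_) (ℕ.+-comm m 1) ν<m+1)

    absurd : ¬ (∃[ k ] G ≅ k copiesOf C₅)
    -- Zero copies would leave no image for a vertex of G, which has at least one.
    absurd (zero , f , _) with Inverse.to f (fromℕ< (ℕ.>-nonZero⁻¹ n))
    ... | () , _
    absurd (suc k , iso) = ≇kC₅ (suc k) (ℕ.s≤s ℕ.z≤n) iso
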